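{- Let $k\ge 2$ and let $G$ be a simple connected $k$-partite graph with $n$ vertices, where $k\leq n-1$, such that the complement $\overline{G}$ is disconnected. Then $$DLS(G)\geq \Big\lfloor \frac{n}{k}\Big\rfloor,$$ with equality if and only if $n\equiv 0 \pmod k$ and $G$ is the complete $k$-partite graph all of whose independent classes have the same cardinality.
   Context: All graphs are finite, simple and connected (complements may be disconnected). For an integer $k\ge 2$, a $k$-partite graph is a graph whose vertex set can be partitioned into $k$ (nonempty) independent classes, so that every edge has its ends in different classes; it is complete $k$-partite if every two vertices from different classes are adjacent. For a connected graph $G$ on vertices $v_1,\dots,v_n$, $d_{uv}$ denotes the distance (length of a shortest path) between $u$ and $v$, and $D(G)=(d_{uv})$ is the distance matrix. The transmission of a vertex $v$ is $Tr(v)=\sum_{u\in V(G)}d_{uv}$. The distance Laplacian matrix is $D^L(G)=\mathrm{diag}(Tr(v_1),\dots,Tr(v_n))-D(G)$; it is positive semidefinite, and its eigenvalues, with multiplicity, are written $\partial_1^L(G)\ge \partial_2^L(G)\ge\dots\ge\partial_n^L(G)=0$. The distance Laplacian spread is $DLS(G)=\partial_1^L(G)-\partial_{n-1}^L(G)$. -}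

module Defs where

open import Algebra.Bundles.Raw using (RawMonoid)
import Algebra.Definitions.RawMonoid as RawMonoidDefinitions
open import Data.Bool.Base using (if_then_else_)
open import Data.Fin.Base as Fin using (Fin; zero; suc; opposite)
import Data.Fin.Properties as Fin
open import Data.Integer.Base as ℤ using ()
open import Data.Nat.Base as ℕ using (ℕ; zero; suc; s≤s; z≤n)
import Data.Nat.Properties as ℕ
open import Data.Product.Base using (Σ; ∃; ∃-syntax; _×_; _,_; proj₁; proj₂)
open import Data.Rational.Base as ℚ using (ℚ; 0ℚ; 1ℚ; ½; Positive; NonZero; 1/_)
import Data.Rational.Properties as ℚ
open import Data.Rational.Solver using (module +-*-Solver)
import Data.Vec.Base as Vec
open import Data.Vec.Functional using (Vector)
open import Function.Definitions using (StrictlySurjective)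
open import Level using (0ℓ)
open import Relation.Binary.Core using (Rel)
open import Relation.Binary.Definitions using (Decidable; Irreflexive; Symmetric)
open import Relation.Binary.PropositionalEquality
open import Relation.Nullary using (Dec; yes; no; ¬_; ¬?; does; contradiction; _×-dec_)

IsCauchy : (ℕ → ℚ) → Set
IsCauchy s = ∀ ε → 0ℚ ℚ.< ε →
  ∃[ N ] ∀ m n → N ℕ.≤ m → N ℕ.≤ n → ℚ.∣ s m ℚ.- s n ∣ ℚ.< ε

record ℝ : Set where
  constructor mkℝ
  field
    seq    : ℕ → ℚ
    cauchy : IsCauchy seq

open ℝ public

infix 4 _≈_ _≤_ _≥_

record _≈_ (x y : ℝ) : Set where
  constructor mk≈
  field
    ≈-eventually : ∀ ε → 0ℚ ℚ.< ε →
      ∃[ N ] ∀ m → N ℕ.≤ m → ℚ.∣ seq x m ℚ.- seq y m ∣ ℚ.< ε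

open _≈_ public

record _≤_ (x y : ℝ) : Set where
  constructor mk≤
  field
    ≤-eventually : ∀ ε → 0ℚ ℚ.< ε →
      ∃[ N ] ∀ m → N ℕ.≤ m → seq x m ℚ.< seq y m ℚ.+ ε

open _≤_ public

_≥_ : Rel ℝ 0ℓ
x ≥ y = y ≤ x

fromℚ : ℚ → ℝ
fromℚ q = mkℝ (λ _ → q) λ ε 0<ε → 0 , λ _ _ _ _ →
  subst (ℚ._< ε) (sym (cong ℚ.∣_∣ (ℚ.+-inverseʳ q))) 0<ε

fromℕ : ℕ → ℝ
fromℕ n = fromℚ (ℤ.+ n ℚ./ 1)

0ℝ : ℝ
0ℝ = fromℚ 0ℚ

ε/2>0 : ∀ {ε} → 0ℚ ℚ.< ε → 0ℚ ℚ.< ½ ℚ.* ε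
ε/2>0 {ε} 0<ε = subst (ℚ._< ½ ℚ.* ε) (ℚ.*-zeroʳ ½) (ℚ.*-monoʳ-<-pos ½ 0<ε)

ε/2+ε/2 : ∀ ε → ½ ℚ.* ε ℚ.+ ½ ℚ.* ε ≡ ε
ε/2+ε/2 ε = trans (sym (ℚ.*-distribʳ-+ ε ½ ½)) (ℚ.*-identityˡ ε)

+-cauchy : ∀ s t → IsCauchy s → IsCauchy t → IsCauchy (λ m → s m ℚ.+ t m)
+-cauchy s t cs ct ε 0<ε
  with M , hs ← cs (½ ℚ.* ε) (ε/2>0 0<ε)
  with N , ht ← ct (½ ℚ.* ε) (ε/2>0 0<ε) = M ℕ.⊔ N , λ m n M⊔N≤m M⊔N≤n → begin-strict
    ℚ.∣ (s m ℚ.+ t m) ℚ.- (s n ℚ.+ t n) ∣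
      ≡⟨ cong ℚ.∣_∣ (solve 4 (λ a b c d → (a :+ b) :- (c :+ d) := (a :- c) :+ (b :- d)) refl
           (s m) (t m) (s n) (t n)) ⟩
    ℚ.∣ (s m ℚ.- s n) ℚ.+ (t m ℚ.- t n) ∣
      ≤⟨ ℚ.∣p+q∣≤∣p∣+∣q∣ (s m ℚ.- s n) (t m ℚ.- t n) ⟩
    ℚ.∣ s m ℚ.- s n ∣ ℚ.+ ℚ.∣ t m ℚ.- t n ∣
      <⟨ ℚ.+-mono-< (hs m n (ℕ.m⊔n≤o⇒m≤o M N M⊔N≤m) (ℕ.m⊔n≤o⇒m≤o M N M⊔N≤n))
                    (ht m n (ℕ.m⊔n≤o⇒n≤o M N M⊔N≤m) (ℕ.m⊔n≤o⇒n≤o M N M⊔N≤n)) ⟩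
    ½ ℚ.* ε ℚ.+ ½ ℚ.* ε
      ≡⟨ ε/2+ε/2 ε ⟩
    ε ∎
  where
  open ℚ.≤-Reasoning
  open +-*-Solver

neg-cauchy : ∀ s → IsCauchy s → IsCauchy (λ m → ℚ.- s m)
neg-cauchy s cs ε 0<ε with N , h ← cs ε 0<ε = N , λ m n N≤m N≤n →
  subst (ℚ._< ε)
    (trans (sym (ℚ.∣-p∣≡∣p∣ (s m ℚ.- s n)))
           (cong ℚ.∣_∣ (solve 2 (λ a b → :- (a :- b) := (:- a) :- (:- b)) refl (s m) (s n))))
    (h m n N≤m N≤n)
  where open +-*-Solver

bounded : ∀ s → IsCauchy s →
  ∃[ B ] Positive B × ∃[ N ] (∀ m → N ℕ.≤ m → ℚ.∣ s m ∣ ℚ.≤ B)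
bounded s cs with N , h ← cs 1ℚ (ℚ.positive⁻¹ 1ℚ) =
  1ℚ ℚ.+ ℚ.∣ s N ∣ ,
  ℚ.pos+nonNeg⇒pos 1ℚ ℚ.∣ s N ∣ {{ℚ.∣-∣-nonNeg (s N)}} ,
  N , λ m N≤m → begin
    ℚ.∣ s m ∣
      ≡⟨ cong ℚ.∣_∣ (solve 2 (λ a b → a := (a :- b) :+ b) refl (s m) (s N)) ⟩
    ℚ.∣ (s m ℚ.- s N) ℚ.+ s N ∣
      ≤⟨ ℚ.∣p+q∣≤∣p∣+∣q∣ (s m ℚ.- s N) (s N) ⟩
    ℚ.∣ s m ℚ.- s N ∣ ℚ.+ ℚ.∣ s N ∣
      ≤⟨ ℚ.+-monoˡ-≤ ℚ.∣ s N ∣ (ℚ.<⇒≤ (h m N N≤m ℕ.≤-refl)) ⟩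
    1ℚ ℚ.+ ℚ.∣ s N ∣ ∎
  where
  open ℚ.≤-Reasoning
  open +-*-Solver

tolerance : ∀ B → Positive B → ∀ ε → 0ℚ ℚ.< ε →
  ∃[ δ ] 0ℚ ℚ.< δ × B ℚ.* δ ≡ ½ ℚ.* ε
tolerance B B>0 ε 0<ε = 1/B ℚ.* (½ ℚ.* ε) ,
  subst (ℚ._< 1/B ℚ.* (½ ℚ.* ε)) (ℚ.*-zeroʳ 1/B)
    (ℚ.*-monoʳ-<-pos 1/B {{ℚ.1/pos⇒pos B {{B>0}}}} (ε/2>0 0<ε)) ,
  trans (sym (ℚ.*-assoc B 1/B (½ ℚ.* ε)))
    (trans (cong (ℚ._* (½ ℚ.* ε)) (ℚ.*-inverseʳ B {{B≢0}})) (ℚ.*-identityˡ (½ ℚ.* ε)))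
  where
  B≢0 : NonZero B
  B≢0 = ℚ.pos⇒nonZero B {{B>0}}
  1/B : ℚ
  1/B = (1/ B) {{B≢0}}

*-bound : ∀ {p q B δ} → Positive B → ℚ.∣ p ∣ ℚ.≤ B → ℚ.∣ q ∣ ℚ.< δ →
  ℚ.∣ p ℚ.* q ∣ ℚ.< B ℚ.* δ
*-bound {p} {q} {B} {δ} B>0 p≤B q<δ = begin-strict
  ℚ.∣ p ℚ.* q ∣         ≡⟨ ℚ.∣p*q∣≡∣p∣*∣q∣ p q ⟩
  ℚ.∣ p ∣ ℚ.* ℚ.∣ q ∣   ≤⟨ ℚ.*-monoʳ-≤-nonNeg ℚ.∣ q ∣ {{ℚ.∣-∣-nonNeg q}} p≤B ⟩
  B ℚ.* ℚ.∣ q ∣         <⟨ ℚ.*-monoʳ-<-pos B {{B>0}} q<δ ⟩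
  B ℚ.* δ               ∎
  where open ℚ.≤-Reasoning

*-close : ∀ a b c d {ε α β} ((A , _) (B , _) : ∃ Positive) →
  A ℚ.* α ≡ ½ ℚ.* ε → B ℚ.* β ≡ ½ ℚ.* ε →
  ℚ.∣ a ∣ ℚ.≤ A → ℚ.∣ d ∣ ℚ.≤ B →
  ℚ.∣ a ℚ.- c ∣ ℚ.< β → ℚ.∣ b ℚ.- d ∣ ℚ.< α →
  ℚ.∣ a ℚ.* b ℚ.- c ℚ.* d ∣ ℚ.< ε
*-close a b c d {ε} {α} {β} (A , A>0) (B , B>0) Aα Bβ a≤A d≤B a-c b-d = begin-strict
  ℚ.∣ a ℚ.* b ℚ.- c ℚ.* d ∣
    ≡⟨ cong ℚ.∣_∣ (solve 4 (λ a b c d → a :* b :- c :* d := a :* (b :- d) :+ d :* (a :- c)) refl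
         a b c d) ⟩
  ℚ.∣ a ℚ.* (b ℚ.- d) ℚ.+ d ℚ.* (a ℚ.- c) ∣
    ≤⟨ ℚ.∣p+q∣≤∣p∣+∣q∣ (a ℚ.* (b ℚ.- d)) (d ℚ.* (a ℚ.- c)) ⟩
  ℚ.∣ a ℚ.* (b ℚ.- d) ∣ ℚ.+ ℚ.∣ d ℚ.* (a ℚ.- c) ∣
    <⟨ ℚ.+-mono-< (*-bound {a} {b ℚ.- d} A>0 a≤A b-d) (*-bound {d} {a ℚ.- c} B>0 d≤B a-c) ⟩
  A ℚ.* α ℚ.+ B ℚ.* β
    ≡⟨ cong₂ ℚ._+_ Aα Bβ ⟩
  ½ ℚ.* ε ℚ.+ ½ ℚ.* ε
    ≡⟨ ε/2+ε/2 ε ⟩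
  ε ∎
  where
  open ℚ.≤-Reasoning
  open +-*-Solver

*-cauchy : ∀ s t → IsCauchy s → IsCauchy t → IsCauchy (λ m → s m ℚ.* t m)
*-cauchy s t cs ct ε 0<ε =
  let A , A>0 , K , sA = bounded s cs
      B , B>0 , L , tB = bounded t ct
      α , 0<α , Aα = tolerance A A>0 ε 0<ε
      β , 0<β , Bβ = tolerance B B>0 ε 0<ε
      M , hs = cs β 0<β
      N , ht = ct α 0<α
  in (K ℕ.⊔ L) ℕ.⊔ (M ℕ.⊔ N) , λ m n ≤m ≤n →
    let KL≤m = ℕ.m⊔n≤o⇒m≤o (K ℕ.⊔ L) (M ℕ.⊔ N) ≤m
        MN≤m = ℕ.m⊔n≤o⇒n≤o (K ℕ.⊔ L) (M ℕ.⊔ N) ≤m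
        KL≤n = ℕ.m⊔n≤o⇒m≤o (K ℕ.⊔ L) (M ℕ.⊔ N) ≤n
        MN≤n = ℕ.m⊔n≤o⇒n≤o (K ℕ.⊔ L) (M ℕ.⊔ N) ≤n
    in *-close (s m) (t m) (s n) (t n) (A , A>0) (B , B>0) Aα Bβ
         (sA m (ℕ.m⊔n≤o⇒m≤o K L KL≤m)) (tB n (ℕ.m⊔n≤o⇒n≤o K L KL≤n))
         (hs m n (ℕ.m⊔n≤o⇒m≤o M N MN≤m) (ℕ.m⊔n≤o⇒m≤o M N MN≤n))
         (ht m n (ℕ.m⊔n≤o⇒n≤o M N MN≤m) (ℕ.m⊔n≤o⇒n≤o M N MN≤n))

infixl 6 _+_ _-_
infixl 7 _*_
infix  8 -_

_+_ : ℝ → ℝ → ℝ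
x + y = mkℝ (λ m → seq x m ℚ.+ seq y m) (+-cauchy (seq x) (seq y) (cauchy x) (cauchy y))

-_ : ℝ → ℝ
- x = mkℝ (λ m → ℚ.- seq x m) (neg-cauchy (seq x) (cauchy x))

_*_ : ℝ → ℝ → ℝ
x * y = mkℝ (λ m → seq x m ℚ.* seq y m) (*-cauchy (seq x) (seq y) (cauchy x) (cauchy y))

_-_ : ℝ → ℝ → ℝ
x - y = x + (- y)

+-rawMonoid : RawMonoid 0ℓ 0ℓ
+-rawMonoid = record { Carrier = ℝ ; _≈_ = _≈_ ; _∙_ = _+_ ; ε = 0ℝ }

open RawMonoidDefinitions +-rawMonoid public using (sum)
open RawMonoidDefinitions ℕ.+-0-rawMonoid public using () renaming (sum to sumℕ)

Matrix : ℕ → Set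
Matrix n = Fin n → Fin n → ℝ

infixr 7 _*ᵥ_

_*ᵥ_ : ∀ {n} → Matrix n → Vector ℝ n → Vector ℝ n
(M *ᵥ x) i = sum λ j → M i j * x j

combination : ∀ {m n} → Vector ℝ m → Vector (Vector ℝ n) m → Vector ℝ n
combination c b j = sum λ i → c i * b i j

LinearlyIndependent : ∀ {m n} → Vector (Vector ℝ n) m → Set
LinearlyIndependent b =
  ∀ c → (∀ j → combination c b j ≈ 0ℝ) → ∀ i → c i ≈ 0ℝ

Spanning : ∀ {m n} → Vector (Vector ℝ n) m → Set
Spanning {n = n} b =
  ∀ (x : Vector ℝ n) → ∃[ c ] ∀ j → x j ≈ combination c b j

IsBasis : ∀ {m n} → Vector (Vector ℝ n) m → Set
IsBasis b = LinearlyIndependent b × Spanning b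

-- ∂ lists the eigenvalues of M in non-increasing order, each repeated
-- according to its multiplicity: the vectors b i with ∂ i ≈ μ form a basis
-- of the μ-eigenspace.  Such a ∂ exists for every symmetric M, and is unique
-- up to ≈.  Index i of Fin n stands for the subscript i + 1.
IsSpectrum : ∀ {n} → Matrix n → Vector ℝ n → Set
IsSpectrum {n} M ∂ =
  (∀ {i j} → i Fin.≤ j → ∂ i ≥ ∂ j) ×
  Σ (Vector (Vector ℝ n) n) λ b →
    IsBasis b × (∀ i j → (M *ᵥ b i) j ≈ ∂ i * b i j)

-- ∂₁ - ∂ₙ₋₁; for n = 2 + m the entry ∂ₙ₋₁ is the second one from the end.
spread : ∀ {n} → 2 ℕ.≤ n → Vector ℝ n → ℝ
spread (s≤s (s≤s z≤n)) ∂ = ∂ zero - ∂ (opposite (suc zero))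

-- Finite simple graphs, with vertex set Fin n.
record Graph (n : ℕ) : Set₁ where
  infix 4 _~_ _~?_
  field
    _~_    : Rel (Fin n) 0ℓ
    _~?_   : Decidable _~_
    ~-sym  : Symmetric _~_
    irrefl : Irreflexive _≡_ _~_

complement : ∀ {n} → Graph n → Graph n
complement G = record
  { _~_    = λ u v → u ≢ v × ¬ (u ~ v)
  ; _~?_   = λ u v → ¬? (u Fin.≟ v) ×-dec ¬? (u ~? v)
  ; ~-sym  = λ (u≢v , u≁v) → (λ v≡u → u≢v (sym v≡u)) , λ v~u → u≁v (~-sym v~u)
  ; irrefl = λ u≡v (u≢v , _) → u≢v u≡v
  }
  where open Graph G

module _ {n : ℕ} (G : Graph n) where
  open Graph G

  data Walk : ℕ → Fin n → Fin n → Set where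
    here : ∀ {u} → Walk 0 u u
    step : ∀ {ℓ u v w} → u ~ v → Walk ℓ v w → Walk (suc ℓ) u w

  Connected : Set
  Connected = ∀ u v → ∃[ ℓ ] Walk ℓ u v

  walk? : ∀ ℓ u v → Dec (Walk ℓ u v)
  walk? zero u v with u Fin.≟ v
  ... | yes refl = yes here
  ... | no u≢v   = no λ { here → u≢v refl }
  walk? (suc ℓ) u w with Fin.any? (λ v → (u ~? v) ×-dec walk? ℓ v w)
  ... | yes (v , u~v , p) = yes (step u~v p)
  ... | no ∄v             = no λ { (step u~v p) → ∄v (_ , u~v , p) }

  IsDistance : Fin n → Fin n → ℕ → Set
  IsDistance u v d = Walk d u v × (∀ {ℓ} → Walk ℓ u v → d ℕ.≤ ℓ)

  -- Search upwards from d, given that no walk is shorter than d and that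
  -- one has length d + fuel.
  search : ∀ {u v} fuel d → Walk (d ℕ.+ fuel) u v →
    (∀ {ℓ} → Walk ℓ u v → d ℕ.≤ ℓ) → ∃[ e ] IsDistance u v e
  search {u} {v} fuel d p lower with walk? d u v
  ... | yes q = d , q , lower
  search {u} {v} zero d p lower | no ∄q =
    contradiction (subst (λ ℓ → Walk ℓ u v) (ℕ.+-identityʳ d) p) ∄q
  search {u} {v} (suc fuel) d p lower | no ∄q =
    search fuel (suc d) (subst (λ ℓ → Walk ℓ u v) (ℕ.+-suc d fuel) p)
      λ q → ℕ.≤∧≢⇒< (lower q) λ { refl → ∄q q }

  -- A walk of minimal length is a path, so the distance may be taken over walks.
  dist : Connected → Fin n → Fin n → ℕ
  dist conn u v = proj₁ (search (proj₁ (conn u v)) 0 (proj₂ (conn u v)) λ _ → z≤n)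

  transmission : Connected → Fin n → ℕ
  transmission conn v = sumℕ λ u → dist conn u v

  distanceMatrix : Connected → Matrix n
  distanceMatrix conn u v = fromℕ (dist conn u v)

  diagonal : Vector ℝ n → Matrix n
  diagonal d u v = if does (u Fin.≟ v) then d u else 0ℝ

  distanceLaplacian : Connected → Matrix n
  distanceLaplacian conn u v =
    diagonal (λ w → fromℕ (transmission conn w)) u v - distanceMatrix conn u v

  -- c assigns to each vertex the class it belongs to; surjectivity says that
  -- none of the k classes is empty.
  IsKPartition : ∀ {k} → (Fin n → Fin k) → Set
  IsKPartition c = StrictlySurjective _≡_ c × (∀ {u v} → u ~ v → c u ≢ c v)

  KPartite : ℕ → Set
  KPartite k = ∃[ c ] IsKPartition {k} c

  classSize : ∀ {k} → (Fin n → Fin k) → Fin k → ℕ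
  classSize c i = Vec.count (λ v → c v Fin.≟ i) (Vec.allFin n)

  BalancedCompleteKPartite : ℕ → Set
  BalancedCompleteKPartite k = Σ (Fin n → Fin k) λ c →
    IsKPartition c ×
    (∀ {u v} → c u ≢ c v → u ~ v) ×
    (∀ i j → classSize c i ≡ classSize c j)

{-# OPTIONS --safe #-}

-- Let H be the complement of G.  As H is disconnected, G has diameter at most 2, and on
-- vectors orthogonal to the constants the distance Laplacian is n + L(H), with L(H) the
-- Laplacian of H.  The indicator vector of a component of H gives ∂ₙ₋₁ ≤ n, and a star in H
-- around a vertex of H-degree d ≥ 1 gives ∂₁ ≥ n + d + 1, so that DLS ≥ d + 1.  The class
-- of a vertex lies in its closed H-neighbourhood; hence DLS ≤ ⌊n/k⌋ bounds every class, and
-- every closed H-neighbourhood, by ⌊n/k⌋.  Counting vertices, all classes have exactly n/k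
-- elements and are the H-neighbourhoods, so H is a disjoint union of cliques of size n/k.
-- For such H, L(H) ≤ n/k, and DLS = n/k.
--
-- The order of the reals is stable under double negation, so inequalities between
-- eigenvalues may be proved classically.
module Submission where

open import Defs using (Graph; complement; Walk; here; step; Connected; IsDistance; dist; search;
  sumℕ; transmission; classSize; IsKPartition; KPartite; BalancedCompleteKPartite)
open import Algebra.Bundles using (CommutativeRing)
import Algebra.Properties.CommutativeMonoid.Sum as CommutativeMonoidSum
import Algebra.Properties.Semiring.Sum as SemiringSum
import Algebra.Solver.Ring as RingSolver
open import Algebra.Solver.Ring.AlmostCommutativeRing
  using (fromCommutativeRing; _-Raw-AlmostCommutative⟶_)
open import Algebra.Structures using (IsMonoid; IsGroup; IsAbelianGroup; IsRing)
open import Data.Bool.Base using (if_then_else_)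
open import Data.Fin.Base as Fin using (Fin; zero; suc; toℕ; opposite)
import Data.Fin.Properties as Fin
import Data.Integer.Base as ℤ
import Data.Integer.Properties as ℤ
open import Data.Maybe.Base as Maybe using (Maybe)
open import Data.Nat.Base as ℕ using (ℕ; zero; suc; NonZero; s≤s; z≤n)
open import Data.Nat.DivMod using (_/_; _%_; m/n*n≤m; m*n%n≡0; m*n/n≡m; m≥n⇒m/n>0)
import Data.Nat.Properties as ℕ
open import Data.Product.Base using (∃-syntax; _×_; _,_; proj₁; proj₂)
open import Data.Rational.Base as ℚ using (ℚ; 0ℚ; 1ℚ; ½)
import Data.Rational.Properties as ℚ
open import Data.Rational.Solver using (module +-*-Solver)
import Data.Rational.Unnormalised.Base as ℚᵘ
import Data.Rational.Unnormalised.Properties as ℚᵘ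
open import Data.Sum.Base using (_⊎_; inj₁; inj₂; [_,_]′)
import Data.Vec.Base as Vec
open import Data.Vec.Functional using (Vector)
open import Effect.Monad using (RawMonad)
open import Function.Base using (_∘_; id)
open import Function.Bundles using (_⇔_; mk⇔)
open import Level using (0ℓ)
open import Relation.Binary.Bundles using (Poset)
open import Relation.Binary.Core using (Rel)
open import Relation.Binary.PropositionalEquality as ≡ using (_≡_; _≢_)
import Relation.Binary.Reasoning.PartialOrder as PosetReasoning
import Relation.Binary.Reasoning.Setoid as SetoidReasoning
open import Relation.Binary.Structures using (IsEquivalence)
open import Relation.Nullary using (¬_; Dec; yes; no; contradiction; does; _×-dec_)
open import Relation.Nullary.Decidable using (dec⇒maybe; dec-true; dec-false; ¬¬-excluded-middle)
open import Relation.Nullary.Negation using (¬¬-Monad)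

-- `IsSpectrum` supplies an arbitrary eigenbasis: no orthogonality, and no decision which
-- eigenvalues coincide. So min-max is not at hand, and two substitutes shape the proof. `rayleigh`
-- bounds the energy of any sum of eigenvectors by induction along the antitone list of eigenvalues.
-- The bound ∂ₙ₋₁ ≤ n comes instead from comparing the coordinates of the constants and of an
-- indicator vector. The constant d + 1: the star vector is d at the centre and -1 at its d
-- neighbours. It sums to 0, has squared length d(d + 1), and each of the d edges at the centre
-- contributes (d + 1)² to the energy of L(H), whose quotient is therefore at least d + 1. The lower
-- bound on DLS is obtained through the rigidity argument for equality. If DLS were below ⌊n/k⌋, all
-- classes would have exactly n/k elements; since k < n this is at least 2, so every vertex has a
-- neighbour in H and its star already gives DLS ≥ n/k.

module ℕ-Sum = CommutativeMonoidSum ℕ.+-0-commutativeMonoid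

-- Finite sums and indicators in the natural numbers.

sumℕ-mono-≤ : ∀ {n} {f g : Fin n → ℕ} → (∀ i → f i ℕ.≤ g i) → sumℕ f ℕ.≤ sumℕ g
sumℕ-mono-≤ {zero}  f≤g = z≤n
sumℕ-mono-≤ {suc n} f≤g = ℕ.+-mono-≤ (f≤g zero) (sumℕ-mono-≤ λ i → f≤g (suc i))

sumℕ-const : ∀ n x → sumℕ {n} (λ _ → x) ≡ n ℕ.* x
sumℕ-const zero    x = ≡.refl
sumℕ-const (suc n) x = ≡.cong (x ℕ.+_) (sumℕ-const n x)

sumℕ-squeeze : ∀ {n} {f g : Fin n → ℕ} → (∀ i → f i ℕ.≤ g i) → sumℕ g ℕ.≤ sumℕ f → ∀ i → f i ≡ g i
sumℕ-squeeze {suc n} {f} {g} f≤g ∑g≤∑f zero = ℕ.≤-antisym (f≤g zero)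
  (ℕ.+-cancelʳ-≤ _ _ _ (ℕ.≤-trans ∑g≤∑f (ℕ.+-monoʳ-≤ (f zero) (sumℕ-mono-≤ λ i → f≤g (suc i)))))
sumℕ-squeeze {suc n} {f} {g} f≤g ∑g≤∑f (suc i) = sumℕ-squeeze (λ i → f≤g (suc i))
  (ℕ.+-cancelˡ-≤ (g zero) _ _ (ℕ.≤-trans ∑g≤∑f (ℕ.+-monoˡ-≤ _ (f≤g zero)))) i

𝟏 : ∀ {A : Set} → Dec A → ℕ
𝟏 a? = if does a? then 1 else 0

𝟏-yes : ∀ {A} (a? : Dec A) → A → 𝟏 a? ≡ 1
𝟏-yes a? a = ≡.cong (if_then 1 else 0) (dec-true a? a)

𝟏-no : ∀ {A} (a? : Dec A) → ¬ A → 𝟏 a? ≡ 0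
𝟏-no a? ¬a = ≡.cong (if_then 1 else 0) (dec-false a? ¬a)

𝟏-01 : ∀ {A} (a? : Dec A) → 𝟏 a? ≡ 0 ⊎ 𝟏 a? ≡ 1
𝟏-01 (yes _) = inj₂ ≡.refl
𝟏-01 (no _)  = inj₁ ≡.refl

𝟏-cong : ∀ {A B} (a? : Dec A) (b? : Dec B) → (A → B) → (B → A) → 𝟏 a? ≡ 𝟏 b?
𝟏-cong (yes a) b? f g = ≡.sym (𝟏-yes b? (f a))
𝟏-cong (no ¬a) b? f g = ≡.sym (𝟏-no b? (¬a ∘ g))

𝟏-≤-+ : ∀ {A B C} (a? : Dec A) (b? : Dec B) (c? : Dec C) → (A → B ⊎ C) → 𝟏 a? ℕ.≤ 𝟏 b? ℕ.+ 𝟏 c?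
𝟏-≤-+ (no _)  _       _       f = z≤n
𝟏-≤-+ (yes _) (yes _) _       f = s≤s z≤n
𝟏-≤-+ (yes a) (no ¬b) c? f with f a
... | inj₁ b = contradiction b ¬b
... | inj₂ c = ℕ.≤-reflexive (≡.sym (𝟏-yes c? c))

sumℕ-𝟏 : ∀ {n} (i : Fin n) → sumℕ (λ j → 𝟏 (i Fin.≟ j)) ≡ 1
sumℕ-𝟏 {suc n} zero = ≡.cong suc (≡.trans (sumℕ-const n 0) (ℕ.*-zeroʳ n))
sumℕ-𝟏 (suc i) = sumℕ-𝟏 i

count-tabulate : ∀ {A : Set} {P : A → Set} (P? : ∀ a → Dec (P a)) {n} (f : Fin n → A) →
  Vec.count P? (Vec.tabulate f) ≡ sumℕ (λ i → 𝟏 (P? (f i)))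
count-tabulate P? {zero}  f = ≡.refl
count-tabulate P? {suc n} f with P? (f zero)
... | yes _ = ≡.cong suc (count-tabulate P? (f ∘ suc))
... | no _  = count-tabulate P? (f ∘ suc)

-- Double negation is applicative, so finitely many classical choices, one for each vertex, can be
-- made at once.
¬¬-sequence : ∀ {n} {P : Fin n → Set} → (∀ i → ¬ ¬ P i) → ¬ ¬ (∀ i → P i)
¬¬-sequence = Fin.sequence (RawMonad.rawApplicative ¬¬-Monad)

-- Walks and class sizes.

module _ {n} (G : Graph n) where

  _⊕_ : ∀ {ℓ m u v w} → Walk G ℓ u v → Walk G m v w → Walk G (ℓ ℕ.+ m) u w
  here     ⊕ q = q
  step e p ⊕ q = step e (p ⊕ q)

  classSize-sum : ∀ {k} (c : Fin n → Fin k) i → classSize G c i ≡ sumℕ (λ v → 𝟏 (c v Fin.≟ i))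
  classSize-sum c i = count-tabulate (λ v → c v Fin.≟ i) id

  ∑-classSize : ∀ {k} (c : Fin n → Fin k) → sumℕ (classSize G c) ≡ n
  ∑-classSize {k} c = begin
    sumℕ (classSize G c)                           ≡⟨ ℕ-Sum.sum-cong-≗ (classSize-sum c) ⟩
    sumℕ (λ i → sumℕ λ v → 𝟏 (c v Fin.≟ i))        ≡⟨ ℕ-Sum.∑-comm {k} {n} (λ i v → 𝟏 (c v Fin.≟ i)) ⟩
    sumℕ (λ v → sumℕ λ i → 𝟏 (c v Fin.≟ i))        ≡⟨ ℕ-Sum.sum-cong-≗ (λ v → sumℕ-𝟏 (c v)) ⟩
    sumℕ {n} (λ _ → 1)                             ≡⟨ ≡.trans (sumℕ-const n 1) (ℕ.*-identityʳ n) ⟩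
    n                                              ∎
    where open ≡.≡-Reasoning

-- The complement: distances, cuts, and codegrees against class sizes.

module _ {n} (G : Graph n) where
  open Graph G
  private module C = Graph (complement G)

  coadj : Fin n → Fin n → ℕ
  coadj u v = 𝟏 (u C.~? v)

  codegree : Fin n → ℕ
  codegree u = sumℕ (coadj u)

  coadj-sym : ∀ u v → coadj u v ≡ coadj v u
  coadj-sym u v = 𝟏-cong (u C.~? v) (v C.~? u) C.~-sym C.~-sym

  coadj-irrefl : ∀ u → coadj u u ≡ 0
  coadj-irrefl u = 𝟏-no (u C.~? u) (C.irrefl ≡.refl)

  module _ (disconnected : ¬ Connected (complement G)) where

    -- Without a common neighbour of `u` and `v`, every other vertex is joined in the complement to
    -- `u` or to `v`, and these two are joined to each other there. Everything then reaches `u`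
    -- within two steps, and the complement is connected.
    nonadjacent⇒walk₂ : ∀ {u v} → u C.~ v → Walk G 2 u v
    nonadjacent⇒walk₂ {u} {v} u≁v with Fin.any? (λ w → (u ~? w) ×-dec (w ~? v))
    ... | yes (w , u~w , w~v) = step u~w (step w~v here)
    ... | no ∄w = contradiction
      (λ x y → _ , _⊕_ (complement G) (proj₂ (to-u x)) (proj₂ (from-u y))) disconnected
      where
      v≁u = C.~-sym {u} {v} u≁v
      to-u : ∀ w → ∃[ ℓ ] Walk (complement G) ℓ w u
      to-u w with w Fin.≟ u | u ~? w | w Fin.≟ v
      ... | yes ≡.refl | _ | _ = 0 , here
      ... | no w≢u | no u≁w | _ = 1 , step (w≢u , u≁w ∘ ~-sym) here
      ... | no _ | yes _ | yes ≡.refl = 1 , step v≁u here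
      ... | no _ | yes u~w | no w≢v = 2 , step (w≢v , λ w~v → ∄w (w , u~w , w~v)) (step v≁u here)
      from-u : ∀ w → ∃[ ℓ ] Walk (complement G) ℓ u w
      from-u w with w Fin.≟ u | u ~? w | w Fin.≟ v
      ... | yes ≡.refl | _ | _ = 0 , here
      ... | no w≢u | no u≁w | _ = 1 , step ((λ u≡w → w≢u (≡.sym u≡w)) , u≁w) here
      ... | no _ | yes _ | yes ≡.refl = 1 , step u≁v here
      ... | no _ | yes u~w | no w≢v = 2 , step u≁v
        (step ((λ v≡w → w≢v (≡.sym v≡w)) , λ v~w → ∄w (w , u~w , ~-sym v~w)) here)

    distance-unique : ∀ {u v d d′} → IsDistance G u v d → IsDistance G u v d′ → d ≡ d′
    distance-unique (p , p-min) (q , q-min) = ℕ.≤-antisym (p-min q) (q-min p)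

    dist-≢ : (conn : Connected G) → ∀ {u v} → u ≢ v → dist G conn u v ≡ suc (coadj u v)
    dist-≢ conn {u} {v} u≢v = distance-unique
      (proj₂ (search G _ 0 (proj₂ (conn u v)) λ _ → z≤n)) (isDistance (u ~? v))
      where
      1≤ : ∀ {ℓ} → Walk G ℓ u v → 1 ℕ.≤ ℓ
      1≤ here = contradiction ≡.refl u≢v
      1≤ (step _ _) = s≤s z≤n
      2≤ : ¬ (u ~ v) → ∀ {ℓ} → Walk G ℓ u v → 2 ℕ.≤ ℓ
      2≤ u≁v here = contradiction ≡.refl u≢v
      2≤ u≁v (step u~v here) = contradiction u~v u≁v
      2≤ u≁v (step _ (step _ _)) = s≤s (s≤s z≤n)
      isDistance : Dec (u ~ v) → IsDistance G u v (suc (coadj u v))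
      isDistance (yes u~v) = ≡.subst (IsDistance G u v)
        (≡.cong suc (≡.sym (𝟏-no (u C.~? v) λ (_ , u≁v) → u≁v u~v))) (step u~v here , 1≤)
      isDistance (no u≁v) = ≡.subst (IsDistance G u v)
        (≡.cong suc (≡.sym (𝟏-yes (u C.~? v) (u≢v , u≁v)))) (nonadjacent⇒walk₂ (u≢v , u≁v) , 2≤ u≁v)

    dist-sym : (conn : Connected G) → ∀ u v → dist G conn u v ≡ dist G conn v u
    dist-sym conn u v = by-cases (u Fin.≟ v)
      where
      by-cases : Dec (u ≡ v) → dist G conn u v ≡ dist G conn v u
      by-cases (yes ≡.refl) = ≡.refl
      by-cases (no u≢v) = ≡.trans (dist-≢ conn u≢v)
        (≡.trans (≡.cong suc (coadj-sym u v)) (≡.sym (dist-≢ conn (u≢v ∘ ≡.sym))))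

    -- A nontrivial union of components of the complement with decidable membership. Closedness in
    -- one direction suffices, adjacency being symmetric.
    record Cut : Set₁ where
      field
        Side      : Fin n → Set
        side?     : ∀ w → Dec (Side w)
        closed    : ∀ {v w} → v C.~ w → Side v → Side w
        inside    : ∃[ u ] Side u
        outside   : ∃[ v ] ¬ Side v

    -- Excluded middle for reachability from `u` may be assumed at all vertices at once. The
    -- vertices reachable from `u` then form a cut, unless every `v` is among them; without cuts the
    -- complement would thus be connected, up to double negation.
    ¬¬cut : ¬ ¬ Cut
    ¬¬cut ¬cut = ¬¬-sequence (λ u → ¬¬-sequence λ v → reachable u v) disconnected
      where
      reachable : ∀ u v → ¬ ¬ (∃[ ℓ ] Walk (complement G) ℓ u v)
      reachable u v ¬p = ¬¬-sequence
        (λ w → ¬¬-excluded-middle {A = ∃[ ℓ ] Walk (complement G) ℓ u w}) λ side? →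
        ¬cut record
          { Side = λ w → ∃[ ℓ ] Walk (complement G) ℓ u w
          ; side? = side?
          ; closed = λ v~w (_ , p) → _ , _⊕_ (complement G) p (step v~w here)
          ; inside = u , 0 , here
          ; outside = v , ¬p }

  module _ {k} {c : Fin n → Fin k} (c-partition : IsKPartition G c) where
    private
      proper = proj₂ c-partition

      ∑-𝟏+coadj : ∀ u → sumℕ (λ w → 𝟏 (u Fin.≟ w) ℕ.+ coadj u w) ≡ suc (codegree u)
      ∑-𝟏+coadj u = ≡.trans (ℕ-Sum.∑-distrib-+ {n} _ _) (≡.cong (ℕ._+ codegree u) (sumℕ-𝟏 u))

      pointwise : ∀ u w → 𝟏 (c w Fin.≟ c u) ℕ.≤ 𝟏 (u Fin.≟ w) ℕ.+ coadj u w
      pointwise u w = 𝟏-≤-+ (c w Fin.≟ c u) (u Fin.≟ w) (u C.~? w) λ cw≡cu → by-cases cw≡cu (u Fin.≟ w)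
        where
        by-cases : c w ≡ c u → Dec (u ≡ w) → u ≡ w ⊎ u C.~ w
        by-cases cw≡cu (yes u≡w) = inj₁ u≡w
        by-cases cw≡cu (no u≢w) = inj₂ (u≢w , λ u~w → proper u~w (≡.sym cw≡cu))

    classSize≤1+codegree : ∀ u → classSize G c (c u) ℕ.≤ suc (codegree u)
    classSize≤1+codegree u = ≡.subst₂ ℕ._≤_ (≡.sym (classSize-sum G c (c u))) (∑-𝟏+coadj u)
      (sumℕ-mono-≤ (pointwise u))

    -- Here `v` belongs to the closed neighbourhood of `u` in the complement but not to the class of
    -- `u`. The indicator of the neighbourhood therefore still dominates that of the class with `v`
    -- added: at `w = v` both sides are 1.
    classSize<1+codegree : ∀ {u v} → c u ≢ c v → ¬ (u ~ v) → classSize G c (c u) ℕ.< suc (codegree u)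
    classSize<1+codegree {u} {v} cu≢cv u≁v = ≡.subst₂ ℕ._≤_
      (≡.trans (ℕ-Sum.∑-distrib-+ {n} _ _)
        (≡.cong₂ ℕ._+_ (sumℕ-𝟏 v) (≡.sym (classSize-sum G c (c u)))))
      (∑-𝟏+coadj u)
      (sumℕ-mono-≤ λ w → pointwise′ w (v Fin.≟ w))
      where
      pointwise′ : ∀ w → (v≟w : Dec (v ≡ w)) → 𝟏 v≟w ℕ.+ 𝟏 (c w Fin.≟ c u) ℕ.≤ 𝟏 (u Fin.≟ w) ℕ.+ coadj u w
      pointwise′ w (no _) = pointwise u w
      pointwise′ w (yes ≡.refl) = ℕ.≤-reflexive (≡.trans
        (≡.cong suc (𝟏-no (c v Fin.≟ c u) (cu≢cv ∘ ≡.sym)))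
        (≡.sym (≡.cong₂ ℕ._+_ (𝟏-no (u Fin.≟ v) (cu≢cv ∘ ≡.cong c))
                              (𝟏-yes (u C.~? v) (cu≢cv ∘ ≡.cong c , u≁v)))))

  -- With `s = n / k`, every class has at most `s` elements, while the `k` classes hold `n ≥ s * k`
  -- vertices; so nothing is lost anywhere. A nonadjacent pair across two classes would push a
  -- closed neighbourhood above `s`.
  balanced-of-codegree-≤ : ∀ {k} .{{_ : ℕ.NonZero k}} {c : Fin n → Fin k} → IsKPartition G c →
    k ℕ.≤ n → (∀ u → 1 ℕ.≤ codegree u → suc (codegree u) ℕ.≤ n / k) →
    (∀ i → classSize G c i ≡ n / k) × (∀ {u v} → c u ≢ c v → u ~ v) × n ≡ n / k ℕ.* k
  balanced-of-codegree-≤ {k} {c} c-partition k≤n bound = size≡ , complete , n≡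
    where
    s = n / k
    bound′ : ∀ u → suc (codegree u) ℕ.≤ s
    bound′ u with codegree u in eq
    -- `bound` is silent at codegree 0, where there is no star; there `1 ≤ n / k` comes from
    -- `k ≤ n`.
    ... | zero  = m≥n⇒m/n>0 k≤n
    ... | suc d = ≡.subst (λ d → suc d ℕ.≤ s) eq (bound u (≡.subst (1 ℕ.≤_) (≡.sym eq) (s≤s z≤n)))
    size≤ : ∀ i → classSize G c i ℕ.≤ s
    size≤ i with u , ≡.refl ← proj₁ c-partition i =
      ℕ.≤-trans (classSize≤1+codegree c-partition u) (bound′ u)
    sk≤n : sumℕ {k} (λ _ → s) ℕ.≤ sumℕ (classSize G c)
    sk≤n = ≡.subst₂ ℕ._≤_ (≡.trans (ℕ.*-comm s k) (≡.sym (sumℕ-const k s))) (≡.sym (∑-classSize G c))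
      (m/n*n≤m n k)
    size≡ : ∀ i → classSize G c i ≡ s
    size≡ = sumℕ-squeeze size≤ sk≤n
    n≡ : n ≡ s ℕ.* k
    n≡ = ≡.trans (≡.sym (∑-classSize G c)) (≡.trans (ℕ-Sum.sum-cong-≗ size≡)
      (≡.trans (sumℕ-const k s) (ℕ.*-comm k s)))
    complete : ∀ {u v} → c u ≢ c v → u ~ v
    complete {u} {v} cu≢cv with u ~? v
    ... | yes u~v = u~v
    ... | no u≁v = contradiction
      (ℕ.≤-trans (classSize<1+codegree c-partition cu≢cv u≁v) (bound′ u))
      (ℕ.≤⇒≯ (ℕ.≤-reflexive (≡.sym (size≡ (c u)))))

  balanced-classSize : ∀ {k} .{{_ : ℕ.NonZero k}} (c : Fin n → Fin k) →
    (∀ i j → classSize G c i ≡ classSize G c j) → ∀ i → classSize G c i ≡ n / k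
  balanced-classSize {k} c equal i = ≡.sym (≡.trans (≡.cong (_/ k) n≡) (m*n/n≡m (classSize G c i) k))
    where
    n≡ : n ≡ classSize G c i ℕ.* k
    n≡ = ≡.trans (≡.sym (∑-classSize G c)) (≡.trans (ℕ-Sum.sum-cong-≗ λ j → equal j i)
      (≡.trans (sumℕ-const k _) (ℕ.*-comm k _)))

-- Positions of the last two eigenvalues.

second-to-last-cover : ∀ {m} (i : Fin (suc (suc m))) →
  i Fin.≤ opposite {suc (suc m)} (suc zero) ⊎ i ≡ opposite zero
second-to-last-cover {m} i with toℕ i ℕ.≤? m
... | yes i≤m = inj₁ (≡.subst (toℕ i ℕ.≤_) (≡.sym (Fin.opposite-prop {suc (suc m)} (suc zero))) i≤m)
... | no i≰m = inj₂ (Fin.toℕ-injective (≡.trans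
  (ℕ.≤-antisym (ℕ.≤-pred (Fin.toℕ<n i)) (ℕ.≰⇒> i≰m)) (≡.sym (Fin.opposite-prop {suc (suc m)} zero))))

second-to-last≤last : ∀ {m} → opposite {suc (suc m)} (suc zero) Fin.≤ opposite {suc (suc m)} zero
second-to-last≤last {m} = ≡.subst₂ ℕ._≤_ (≡.sym (Fin.opposite-prop {suc (suc m)} (suc zero)))
  (≡.sym (Fin.opposite-prop {suc (suc m)} zero)) (ℕ.n≤1+n m)

second-to-last≢last : ∀ {m} → opposite {suc (suc m)} (suc zero) ≢ opposite {suc (suc m)} zero
second-to-last≢last {m} eq = ℕ.1+n≢n (≡.trans (≡.sym (Fin.opposite-prop {suc (suc m)} zero))
  (≡.trans (≡.cong toℕ (≡.sym eq)) (Fin.opposite-prop {suc (suc m)} (suc zero))))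

-- The fields ≤-stable and ≰⇒≥ allow comparisons to be proved classically.  Working over an
-- abstract ring prevents Agda from unfolding Cauchy moduli during unification.
record OrderedRing : Set₁ where
  field
    commutativeRing : CommutativeRing 0ℓ 0ℓ
  open CommutativeRing commutativeRing public hiding (zero)
  infix 4 _≤_
  field
    _≤_         : Rel Carrier 0ℓ
    ≤-reflexive : ∀ {x y} → x ≈ y → x ≤ y
    ≤-trans     : ∀ {x y z} → x ≤ y → y ≤ z → x ≤ z
    ≤-antisym   : ∀ {x y} → x ≤ y → y ≤ x → x ≈ y
    +-mono-≤    : ∀ {x y u v} → x ≤ y → u ≤ v → x + u ≤ y + v
    ≤-stable    : ∀ {x y} → ¬ ¬ (x ≤ y) → x ≤ y
    ≰⇒≥         : ∀ {x y} → ¬ (x ≤ y) → y ≤ x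
    *-cancelʳ-≤0 : ∀ {x t} → ¬ (t ≤ 0#) → x * t ≤ 0# → x ≤ 0#
    1≰0         : ¬ (1# ≤ 0#)
    ℤ-homo      : ℤ.+-*-rawRing -Raw-AlmostCommutative⟶ fromCommutativeRing commutativeRing

-- Order arithmetic in an abstract ordered ring.

module Ordered (R : OrderedRing) where
  open OrderedRing R public
  open _-Raw-AlmostCommutative⟶_ ℤ-homo public using ()
    renaming (⟦_⟧ to ι; +-homo to ι-+; *-homo to ι-*; -‿homo to ι-neg; 0-homo to ι-0; 1-homo to ι-1)
  open SemiringSum semiring public
    using (sum; sum-cong-≋; ∑-distrib-+; ∑-comm; *-distribˡ-sum; *-distribʳ-sum; sum-replicate-zero)

  private
    -- ι, adjusted so that the constants 0 and 1 of the solver evaluate to 0# and 1#.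
    κ : ℤ.ℤ → Carrier
    κ (ℤ.+ 0) = 0#
    κ (ℤ.+ 1) = 1#
    κ i       = ι i

    κ≈ι : ∀ i → κ i ≈ ι i
    κ≈ι (ℤ.+ 0)           = sym ι-0
    κ≈ι (ℤ.+ 1)           = sym ι-1
    κ≈ι (ℤ.+ suc (suc _)) = refl
    κ≈ι ℤ.-[1+ _ ]        = refl

    κ-homo : ℤ.+-*-rawRing -Raw-AlmostCommutative⟶ fromCommutativeRing commutativeRing
    κ-homo = record
      { ⟦_⟧ = κ
      ; +-homo = λ i j → trans (κ≈ι (i ℤ.+ j)) (trans (ι-+ i j) (sym (+-cong (κ≈ι i) (κ≈ι j))))
      ; *-homo = λ i j → trans (κ≈ι (i ℤ.* j)) (trans (ι-* i j) (sym (*-cong (κ≈ι i) (κ≈ι j))))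
      ; -‿homo = λ i → trans (κ≈ι (ℤ.- i)) (trans (ι-neg i) (sym (-‿cong (κ≈ι i))))
      ; 0-homo = refl
      ; 1-homo = refl
      }

    _κ≟_ : ∀ i j → Maybe (κ i ≈ κ j)
    i κ≟ j = Maybe.map (λ i≡j → reflexive (≡.cong κ i≡j)) (dec⇒maybe (i ℤ.≟ j))

  module Solver = RingSolver ℤ.+-*-rawRing (fromCommutativeRing commutativeRing) κ-homo _κ≟_

  ≤-refl : ∀ {x} → x ≤ x
  ≤-refl = ≤-reflexive refl

  ≤-poset : Poset 0ℓ 0ℓ 0ℓ
  ≤-poset = record
    { isPartialOrder = record
      { isPreorder = record
        { isEquivalence = isEquivalence ; reflexive = ≤-reflexive ; trans = ≤-trans }
      ; antisym = ≤-antisym } }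

  module ≤-Reasoning = PosetReasoning ≤-poset
  module ≈-Reasoning = SetoidReasoning setoid

  open Solver

  x≤y⇒x-y≤0 : ∀ {x y} → x ≤ y → x - y ≤ 0#
  x≤y⇒x-y≤0 {x} {y} x≤y = ≤-trans (+-mono-≤ x≤y ≤-refl) (≤-reflexive (-‿inverseʳ y))

  x-y≤0⇒x≤y : ∀ {x y} → x - y ≤ 0# → x ≤ y
  x-y≤0⇒x≤y {x} {y} x-y≤0 = begin
    x          ≈⟨ solve 2 (λ x y → x := (x :- y) :+ y) refl x y ⟩
    x - y + y  ≤⟨ +-mono-≤ x-y≤0 ≤-refl ⟩
    0# + y     ≈⟨ +-identityˡ y ⟩
    y          ∎
    where open ≤-Reasoning

  neg-≤0 : ∀ {x} → 0# ≤ x → - x ≤ 0#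
  neg-≤0 {x} 0≤x = ≤-trans (≤-reflexive (sym (+-identityˡ (- x)))) (x≤y⇒x-y≤0 0≤x)

  neg-≥0 : ∀ {x} → x ≤ 0# → 0# ≤ - x
  neg-≥0 {x} x≤0 = x-y≤0⇒x≤y (≤-trans (≤-reflexive
    (solve 1 (λ x → con ℤ.0ℤ :- (:- x) := x) refl x)) x≤0)

  neg-mono-≤ : ∀ {x y} → x ≤ y → - y ≤ - x
  neg-mono-≤ {x} {y} x≤y = x-y≤0⇒x≤y (≤-trans (≤-reflexive
    (solve 2 (λ x y → (:- y) :- (:- x) := x :- y) refl x y)) (x≤y⇒x-y≤0 x≤y))

  0≤x-y⇒y≤x : ∀ {x y} → 0# ≤ x - y → y ≤ x
  0≤x-y⇒y≤x {x} {y} 0≤x-y = x-y≤0⇒x≤y (≤-trans (≤-reflexive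
    (solve 2 (λ x y → y :- x := :- (x :- y)) refl x y)) (neg-≤0 0≤x-y))

  y≤x⇒0≤x-y : ∀ {x y} → y ≤ x → 0# ≤ x - y
  y≤x⇒0≤x-y {x} {y} y≤x = ≤-trans (neg-≥0 (x≤y⇒x-y≤0 y≤x)) (≤-reflexive
    (solve 2 (λ x y → :- (y :- x) := x :- y) refl x y))

  -- If `x` were not `≤ 0#`, it could be cancelled from `x * x ≤ 0#`, leaving `x ≤ 0#` after all;
  -- the same applies to `- x`. Products enter the order axioms only through `*-cancelʳ-≤0`.
  x²≤0⇒x≈0 : ∀ {x} → x * x ≤ 0# → x ≈ 0#
  x²≤0⇒x≈0 {x} xx≤0 = ≤-antisym (≤0 xx≤0) (≤-trans (neg-≥0 -x≤0) (≤-reflexive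
    (solve 1 (λ x → :- (:- x) := x) refl x)))
    where
    ≤0 : ∀ {x} → x * x ≤ 0# → x ≤ 0#
    ≤0 xx≤0 = ≤-stable λ x≰0 → x≰0 (*-cancelʳ-≤0 x≰0 xx≤0)
    -x≤0 : - x ≤ 0#
    -x≤0 = ≤0 (≤-trans (≤-reflexive (solve 1 (λ x → (:- x) :* (:- x) := x :* x) refl x)) xx≤0)

  0≤x² : ∀ x → 0# ≤ x * x
  0≤x² x = ≤-stable λ 0≰xx →
    0≰xx (≤-reflexive (sym (trans (*-congˡ (x²≤0⇒x≈0 (≰⇒≥ 0≰xx))) (zeroʳ x))))

  -- If the product is not nonnegative, it is `≤ 0#`. A positive `y` could then be cancelled, making
  -- `x` and the product zero; so `y ≤ 0#`, hence `y` and the product are zero. Either way the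
  -- product is nonnegative.
  *-nonneg : ∀ {x y} → 0# ≤ x → 0# ≤ y → 0# ≤ x * y
  *-nonneg {x} {y} 0≤x 0≤y = ≤-stable λ 0≰xy →
    let y≤0 = ≤-stable λ y≰0 → 0≰xy (≤-reflexive (sym (trans
          (*-congʳ (≤-antisym (*-cancelʳ-≤0 y≰0 (≰⇒≥ 0≰xy)) 0≤x)) (zeroˡ y))))
    in 0≰xy (≤-reflexive (sym (trans (*-congˡ (≤-antisym y≤0 0≤y)) (zeroʳ x))))

  *-monoʳ-≤ : ∀ {x y t} → 0# ≤ t → x ≤ y → x * t ≤ y * t
  *-monoʳ-≤ {x} {y} {t} 0≤t x≤y = 0≤x-y⇒y≤x (≤-trans (*-nonneg (y≤x⇒0≤x-y x≤y) 0≤t)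
    (≤-reflexive (solve 3 (λ x y t → (y :- x) :* t := y :* t :- x :* t) refl x y t)))

  *-cancelʳ-≤ : ∀ {x y t} → ¬ (t ≤ 0#) → x * t ≤ y * t → x ≤ y
  *-cancelʳ-≤ {x} {y} {t} t≰0 xt≤yt = x-y≤0⇒x≤y (*-cancelʳ-≤0 t≰0 (≤-trans
    (≤-reflexive (solve 3 (λ x y t → (x :- y) :* t := x :* t :- y :* t) refl x y t))
    (x≤y⇒x-y≤0 xt≤yt)))

  *-cancelʳ-≈0 : ∀ {x t} → ¬ (t ≤ 0#) → x * t ≈ 0# → x ≈ 0#
  *-cancelʳ-≈0 {x} {t} t≰0 xt≈0 = ≤-antisym
    (*-cancelʳ-≤0 t≰0 (≤-reflexive xt≈0))
    (*-cancelʳ-≤ t≰0 (≤-reflexive (trans (zeroˡ t) (sym xt≈0))))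

  -- For energies: the sum over ordered pairs of vertices is twice the energy, and the ring has no
  -- division.
  double-cancel-≤ : ∀ {x y} → x + x ≤ y + y → x ≤ y
  double-cancel-≤ {x} {y} h = *-cancelʳ-≤ {t = 1# + 1#}
    (λ 2≤0 → 1≰0 (≤-trans (≤-trans (≤-reflexive (sym (+-identityʳ 1#))) (+-mono-≤ ≤-refl 0≤1)) 2≤0))
    (≤-trans (≤-reflexive (double x)) (≤-trans h (≤-reflexive (sym (double y)))))
    where
    0≤1 = ≰⇒≥ 1≰0
    double : ∀ x → x * (1# + 1#) ≈ x + x
    double = solve 1 (λ x → x :* (con ℤ.1ℤ :+ con ℤ.1ℤ) := x :+ x) refl

  # : ℕ → Carrier
  # n = ι (ℤ.+ n)

  #-suc : ∀ n → # (suc n) ≈ 1# + # n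
  #-suc n = trans (ι-+ ℤ.1ℤ (ℤ.+ n)) (+-congʳ ι-1)

  #-+ : ∀ m n → # (m ℕ.+ n) ≈ # m + # n
  #-+ m n = ι-+ (ℤ.+ m) (ℤ.+ n)

  0≤# : ∀ n → 0# ≤ # n
  0≤# zero    = ≤-reflexive (sym ι-0)
  0≤# (suc n) = begin
    0#        ≈⟨ +-identityˡ 0# ⟨
    0# + 0#   ≤⟨ +-mono-≤ (≰⇒≥ 1≰0) (0≤# n) ⟩
    1# + # n  ≈⟨ #-suc n ⟨
    # (suc n) ∎
    where open ≤-Reasoning

  #-mono-≤ : ∀ {m n} → m ℕ.≤ n → # m ≤ # n
  #-mono-≤ {m} {n} m≤n = begin
    # m                ≈⟨ +-identityʳ (# m) ⟨
    # m + 0#           ≤⟨ +-mono-≤ ≤-refl (0≤# (n ℕ.∸ m)) ⟩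
    # m + # (n ℕ.∸ m)  ≈⟨ #-+ m (n ℕ.∸ m) ⟨
    # (m ℕ.+ (n ℕ.∸ m)) ≡⟨ ≡.cong # (ℕ.m+[n∸m]≡n m≤n) ⟩
    # n                ∎
    where open ≤-Reasoning

  #-suc-≰ : ∀ n → ¬ (# (suc n) ≤ # n)
  #-suc-≰ n h = 1≰0 (begin
    1#              ≈⟨ solve 2 (λ o x → o := (o :+ x) :- x) refl 1# (# n) ⟩
    1# + # n - # n  ≈⟨ +-congʳ (#-suc n) ⟨
    # (suc n) - # n ≤⟨ x≤y⇒x-y≤0 h ⟩
    0#              ∎)
    where open ≤-Reasoning

  #-cancel-≤ : ∀ {m n} → # m ≤ # n → m ℕ.≤ n
  #-cancel-≤ {m} {n} h with m ℕ.≤? n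
  ... | yes m≤n = m≤n
  ... | no m≰n = contradiction (≤-trans (#-mono-≤ (ℕ.≰⇒> m≰n)) h) (#-suc-≰ n)

  -- Finite sums and the inner product.

  ∑-cong : ∀ {n} {x y : Vector Carrier n} → (∀ i → x i ≈ y i) → sum x ≈ sum y
  ∑-cong = sum-cong-≋

  ∑-zero : ∀ {n} {x : Vector Carrier n} → (∀ i → x i ≈ 0#) → sum x ≈ 0#
  ∑-zero {n} x≈0 = trans (∑-cong x≈0) (sum-replicate-zero n)

  ∑-neg : ∀ {n} (x : Vector Carrier n) → sum (λ i → - x i) ≈ - sum x
  ∑-neg x = begin
    sum (λ i → - x i)        ≈⟨ ∑-cong (λ i → solve 1 (λ x → :- x := :- con ℤ.1ℤ :* x) refl (x i)) ⟩
    sum (λ i → - 1# * x i)   ≈⟨ *-distribˡ-sum (- 1#) x ⟨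
    - 1# * sum x             ≈⟨ solve 1 (λ x → :- con ℤ.1ℤ :* x := :- x) refl (sum x) ⟩
    - sum x                  ∎
    where open ≈-Reasoning

  ∑-distrib-- : ∀ {n} (x y : Vector Carrier n) → sum (λ i → x i - y i) ≈ sum x - sum y
  ∑-distrib-- x y = trans (∑-distrib-+ x (λ i → - y i)) (+-congˡ (∑-neg y))

  ∑-const : ∀ n x → sum {n} (λ _ → x) ≈ # n * x
  ∑-const zero x = sym (trans (*-congʳ ι-0) (zeroˡ x))
  ∑-const (suc n) x = begin
    x + sum {n} (λ _ → x)  ≈⟨ +-congˡ (∑-const n x) ⟩
    x + # n * x            ≈⟨ solve 2 (λ x n → x :+ n :* x := (con ℤ.1ℤ :+ n) :* x) refl x (# n) ⟩
    (1# + # n) * x         ≈⟨ *-congʳ (#-suc n) ⟨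
    # (suc n) * x          ∎
    where open ≈-Reasoning

  ∑-single : ∀ {n} (x : Vector Carrier n) i → (∀ j → i ≢ j → x j ≈ 0#) → sum x ≈ x i
  ∑-single x zero h = trans (+-congˡ (∑-zero λ j → h (suc j) λ ())) (+-identityʳ _)
  ∑-single x (suc i) h = trans
    (+-cong (h zero λ ()) (∑-single (λ j → x (suc j)) i λ j i≢j → h (suc j) (i≢j ∘ Fin.suc-injective)))
    (+-identityˡ _)

  ∑-mono-≤ : ∀ {n} {x y : Vector Carrier n} → (∀ i → x i ≤ y i) → sum x ≤ sum y
  ∑-mono-≤ {zero}  x≤y = ≤-refl
  ∑-mono-≤ {suc n} x≤y = +-mono-≤ (x≤y zero) (∑-mono-≤ λ i → x≤y (suc i))

  ∑-nonneg : ∀ {n} {x : Vector Carrier n} → (∀ i → 0# ≤ x i) → 0# ≤ sum x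
  ∑-nonneg {n} 0≤x = ≤-trans (≤-reflexive (sym (sum-replicate-zero n))) (∑-mono-≤ 0≤x)

  ∑-nonneg-≤0 : ∀ {n} {x : Vector Carrier n} → (∀ i → 0# ≤ x i) → sum x ≤ 0# → ∀ i → x i ≤ 0#
  ∑-nonneg-≤0 {x = x} 0≤x h zero = begin
    x zero                          ≈⟨ +-identityʳ _ ⟨
    x zero + 0#                     ≤⟨ +-mono-≤ ≤-refl (∑-nonneg λ i → 0≤x (suc i)) ⟩
    x zero + sum (λ i → x (suc i))  ≤⟨ h ⟩
    0#                              ∎
    where open ≤-Reasoning
  ∑-nonneg-≤0 {x = x} 0≤x h (suc i) = ∑-nonneg-≤0 (λ i → 0≤x (suc i)) (begin
    sum (λ i → x (suc i))           ≈⟨ +-identityˡ _ ⟨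
    0# + sum (λ i → x (suc i))      ≤⟨ +-mono-≤ (0≤x zero) ≤-refl ⟩
    x zero + sum (λ i → x (suc i))  ≤⟨ h ⟩
    0#                              ∎) i
    where open ≤-Reasoning

  ⟨_,_⟩ : ∀ {n} → Vector Carrier n → Vector Carrier n → Carrier
  ⟨ x , y ⟩ = sum λ i → x i * y i

  ⟨⟩-cong : ∀ {n} {x x′ y y′ : Vector Carrier n} → (∀ i → x i ≈ x′ i) → (∀ i → y i ≈ y′ i) →
    ⟨ x , y ⟩ ≈ ⟨ x′ , y′ ⟩
  ⟨⟩-cong x≈x′ y≈y′ = ∑-cong λ i → *-cong (x≈x′ i) (y≈y′ i)

  ⟨⟩-+ˡ : ∀ {n} (x y z : Vector Carrier n) → ⟨ (λ i → x i + y i) , z ⟩ ≈ ⟨ x , z ⟩ + ⟨ y , z ⟩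
  ⟨⟩-+ˡ {n} x y z = trans (∑-cong {n} λ i → distribʳ (z i) (x i) (y i)) (∑-distrib-+ {n} _ _)

  ⟨⟩-comm : ∀ {n} (x y : Vector Carrier n) → ⟨ x , y ⟩ ≈ ⟨ y , x ⟩
  ⟨⟩-comm {n} x y = ∑-cong {n} λ i → *-comm (x i) (y i)

  ⟨⟩-+ʳ : ∀ {n} (x y z : Vector Carrier n) → ⟨ z , (λ i → x i + y i) ⟩ ≈ ⟨ z , x ⟩ + ⟨ z , y ⟩
  ⟨⟩-+ʳ {n} x y z = trans (∑-cong {n} λ i → distribˡ (z i) (x i) (y i)) (∑-distrib-+ {n} _ _)

  ⟨⟩-*ʳ : ∀ {n} a (x y : Vector Carrier n) → ⟨ x , (λ i → a * y i) ⟩ ≈ a * ⟨ x , y ⟩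
  ⟨⟩-*ʳ {n} a x y = trans
    (∑-cong {n} λ i → solve 3 (λ a x y → x :* (a :* y) := a :* (x :* y)) refl a (x i) (y i))
    (sym (*-distribˡ-sum {n} a _))

  0≤⟨x,x⟩ : ∀ {n} (x : Vector Carrier n) → 0# ≤ ⟨ x , x ⟩
  0≤⟨x,x⟩ x = ∑-nonneg λ i → 0≤x² (x i)

  ⟨x,x⟩≤0⇒x≈0 : ∀ {n} (x : Vector Carrier n) → ⟨ x , x ⟩ ≤ 0# → ∀ i → x i ≈ 0#
  ⟨x,x⟩≤0⇒x≈0 x h i = x²≤0⇒x≈0 (∑-nonneg-≤0 (λ i → 0≤x² (x i)) h i)

  -- Weighted graph Laplacians and their quadratic forms.

  Weights : ℕ → Set
  Weights n = Fin n → Fin n → Carrier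

  module _ {n : ℕ} where

    -- The weighted graph Laplacian.
    Δ : Weights n → Vector Carrier n → Vector Carrier n
    Δ w x u = sum λ v → w u v * (x u - x v)

    energy : Weights n → Vector Carrier n → Carrier
    energy w x = ⟨ x , Δ w x ⟩

    Δ-cong : ∀ w {x y} → (∀ u → x u ≈ y u) → ∀ u → Δ w x u ≈ Δ w y u
    Δ-cong w x≈y u = ∑-cong {n} λ v → *-congˡ (+-cong (x≈y u) (-‿cong (x≈y v)))

    Δ-+ : ∀ w x y u → Δ w (λ v → x v + y v) u ≈ Δ w x u + Δ w y u
    Δ-+ w x y u = trans
      (∑-cong {n} λ v → solve 5 (λ w a b c d → w :* ((a :+ b) :- (c :+ d)) := w :* (a :- c) :+ w :* (b :- d))
        refl (w u v) (x u) (y u) (x v) (y v))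
      (∑-distrib-+ {n} _ _)

    Δ-* : ∀ w a x u → Δ w (λ v → a * x v) u ≈ a * Δ w x u
    Δ-* w a x u = trans
      (∑-cong {n} λ v → solve 4 (λ w a b c → w :* (a :* b :- a :* c) := a :* (w :* (b :- c)))
        refl (w u v) a (x u) (x v))
      (sym (*-distribˡ-sum {n} a _))

    Δ-const : ∀ w a u → Δ w (λ _ → a) u ≈ 0#
    Δ-const w a u = ∑-zero {n} λ v → trans (*-congˡ (-‿inverseʳ a)) (zeroʳ (w u v))

    energy-cong : ∀ w {x y} → (∀ u → x u ≈ y u) → energy w x ≈ energy w y
    energy-cong w x≈y = ⟨⟩-cong {n} x≈y (Δ-cong w x≈y)

    ∑∑ : Weights n → Carrier
    ∑∑ f = sum λ u → sum (f u)

    ∑∑-cong : ∀ {f g : Weights n} → (∀ u v → f u v ≈ g u v) → ∑∑ f ≈ ∑∑ g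
    ∑∑-cong h = ∑-cong {n} λ u → ∑-cong {n} (h u)

    ∑∑-+ : ∀ f g → ∑∑ (λ u v → f u v + g u v) ≈ ∑∑ f + ∑∑ g
    ∑∑-+ f g = trans (∑-cong {n} λ u → ∑-distrib-+ {n} (f u) (g u)) (∑-distrib-+ {n} _ _)

    ⟨,Δ⟩-expand : ∀ w x y → ⟨ x , Δ w y ⟩ ≈ ∑∑ λ u v → x u * (w u v * (y u - y v))
    ⟨,Δ⟩-expand w x y = ∑-cong {n} λ u → *-distribˡ-sum {n} (x u) _

    module Symmetric (w : Weights n) (w-sym : ∀ u v → w u v ≈ w v u) where

      -- Of the two parts of each term, `w u v * (x u * y u)` is symmetric in `x` and `y`, and the
      -- cross term becomes so once `u` and `v` are exchanged in the double sum.
      Δ-selfAdjoint : ∀ x y → ⟨ x , Δ w y ⟩ ≈ ⟨ y , Δ w x ⟩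
      Δ-selfAdjoint x y = begin
        ⟨ x , Δ w y ⟩                                  ≈⟨ ⟨,Δ⟩-expand w x y ⟩
        ∑∑ (λ u v → x u * (w u v * (y u - y v)))       ≈⟨ ∑∑-cong (λ u v → split x y u v) ⟩
        ∑∑ (λ u v → w u v * (x u * y u) + cross x y u v) ≈⟨ ∑∑-+ _ _ ⟩
        ∑∑ (λ u v → w u v * (x u * y u)) + ∑∑ (cross x y)
          ≈⟨ +-cong (∑∑-cong λ u v → *-congˡ (*-comm (x u) (y u))) (∑-comm {n} {n} (cross x y)) ⟩
        ∑∑ (λ u v → w u v * (y u * x u)) + ∑∑ (λ u v → cross x y v u)
          ≈⟨ +-congˡ (∑∑-cong λ u v → trans (*-congʳ (w-sym v u))
               (solve 3 (λ w a b → w :* (:- (a :* b)) := w :* (:- (b :* a))) refl (w u v) (x v) (y u))) ⟩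
        ∑∑ (λ u v → w u v * (y u * x u)) + ∑∑ (cross y x) ≈⟨ ∑∑-+ _ _ ⟨
        ∑∑ (λ u v → w u v * (y u * x u) + cross y x u v) ≈⟨ ∑∑-cong (λ u v → split y x u v) ⟨
        ∑∑ (λ u v → y u * (w u v * (x u - x v)))       ≈⟨ ⟨,Δ⟩-expand w y x ⟨
        ⟨ y , Δ w x ⟩                                  ∎
        where
        open ≈-Reasoning
        cross : (x y : Vector Carrier n) → Weights n
        cross x y u v = w u v * - (x u * y v)
        split : ∀ x y u v → x u * (w u v * (y u - y v)) ≈ w u v * (x u * y u) + cross x y u v
        split x y u v = solve 4 (λ a w b c → a :* (w :* (b :- c)) := w :* (a :* b) :+ w :* (:- (a :* c)))
          refl (x u) (w u v) (y u) (y v)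

      -- Pairing `(u , v)` with `(v , u)` completes the square. This is the Dirichlet form over
      -- ordered pairs, hence the doubling.
      energy-+ : ∀ x → energy w x + energy w x ≈ ∑∑ λ u v → w u v * ((x u - x v) * (x u - x v))
      energy-+ x = begin
        energy w x + energy w x  ≈⟨ +-cong (⟨,Δ⟩-expand w x x) (⟨,Δ⟩-expand w x x) ⟩
        ∑∑ f + ∑∑ f              ≈⟨ +-congˡ (∑-comm {n} {n} f) ⟩
        ∑∑ f + ∑∑ (λ u v → f v u) ≈⟨ ∑∑-+ _ _ ⟨
        ∑∑ (λ u v → f u v + f v u)
          ≈⟨ ∑∑-cong (λ u v → trans (+-congˡ (*-congˡ (*-congʳ (w-sym v u))))
               (solve 3 (λ a b w → a :* (w :* (a :- b)) :+ b :* (w :* (b :- a)) := w :* ((a :- b) :* (a :- b)))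
                 refl (x u) (x v) (w u v))) ⟩
        ∑∑ (λ u v → w u v * ((x u - x v) * (x u - x v))) ∎
        where
        open ≈-Reasoning
        f : Weights n
        f u v = x u * (w u v * (x u - x v))

      -- No orthogonality is needed: self-adjointness turns both cross terms of a new
      -- eigenvector v₀ with the rest into α₀ ⟨v₀,V⟩.
      rayleigh : ∀ {m} {a} (α : Vector Carrier m) (v : Vector (Vector Carrier n) m) →
        (∀ i → α i ≤ a) → (∀ {i j} → i Fin.≤ j → α j ≤ α i) →
        (∀ i j → Δ w (v i) j ≈ α i * v i j) →
        let V = λ j → sum λ i → v i j in energy w V ≤ a * ⟨ V , V ⟩
      rayleigh {zero} {a} α v α≤a anti eig = ≤-reflexive (begin
        ⟨ O , Δ w O ⟩  ≈⟨ ∑-zero {n} (λ _ → zeroˡ _) ⟩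
        0#             ≈⟨ zeroʳ a ⟨
        a * 0#         ≈⟨ *-congˡ (∑-zero {n} (λ _ → zeroˡ 0#)) ⟨
        a * ⟨ O , O ⟩  ∎)
        where
        open ≈-Reasoning
        O : Vector Carrier n
        O _ = 0#
      rayleigh {suc m} {a} α v α≤a anti eig = begin
        energy w V
          ≈⟨ ⟨⟩-cong {n} (λ _ → refl) (Δ-+ w v₀ V′) ⟩
        ⟨ V , (λ j → Δ w v₀ j + Δ w V′ j) ⟩
          ≈⟨ trans (⟨⟩-+ʳ {n} _ _ _) (+-cong (⟨⟩-+ˡ {n} _ _ _) (⟨⟩-+ˡ {n} _ _ _)) ⟩
        (⟨ v₀ , Δ w v₀ ⟩ + ⟨ V′ , Δ w v₀ ⟩) + (⟨ v₀ , Δ w V′ ⟩ + energy w V′)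
          ≈⟨ +-cong (+-cong (eig₀ v₀) (eig₀ V′))
               (+-congʳ (trans (Δ-selfAdjoint v₀ V′) (trans (eig₀ V′) (*-congˡ (⟨⟩-comm {n} V′ v₀))))) ⟩
        (α₀ * ⟨ v₀ , v₀ ⟩ + α₀ * ⟨ V′ , v₀ ⟩) + (α₀ * ⟨ v₀ , V′ ⟩ + energy w V′)
          -- The induction hypothesis is used with the bound `α₀`, not `a`: all four terms then
          -- carry the same coefficient and recombine into `⟨ V , V ⟩`. Antitonicity makes `α₀` a
          -- bound for the tail.
          ≤⟨ +-mono-≤ ≤-refl (+-mono-≤ ≤-refl
               (rayleigh (λ i → α (suc i)) (λ i → v (suc i)) (λ i → anti {j = suc i} z≤n)
                 (λ i≤j → anti (s≤s i≤j)) (λ i → eig (suc i)))) ⟩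
        (α₀ * ⟨ v₀ , v₀ ⟩ + α₀ * ⟨ V′ , v₀ ⟩) + (α₀ * ⟨ v₀ , V′ ⟩ + α₀ * ⟨ V′ , V′ ⟩)
          ≈⟨ solve 5 (λ a b c d e → (a :* b :+ a :* c) :+ (a :* d :+ a :* e) := a :* ((b :+ c) :+ (d :+ e)))
               refl α₀ ⟨ v₀ , v₀ ⟩ ⟨ V′ , v₀ ⟩ ⟨ v₀ , V′ ⟩ ⟨ V′ , V′ ⟩ ⟩
        α₀ * ((⟨ v₀ , v₀ ⟩ + ⟨ V′ , v₀ ⟩) + (⟨ v₀ , V′ ⟩ + ⟨ V′ , V′ ⟩))
          ≈⟨ *-congˡ (trans (⟨⟩-+ʳ {n} _ _ _) (+-cong (⟨⟩-+ˡ {n} _ _ _) (⟨⟩-+ˡ {n} _ _ _))) ⟨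
        α₀ * ⟨ V , V ⟩
          ≤⟨ *-monoʳ-≤ (0≤⟨x,x⟩ V) (α≤a zero) ⟩
        a * ⟨ V , V ⟩ ∎
        where
        open ≤-Reasoning
        α₀ = α zero
        v₀ = v zero
        V V′ : Vector Carrier n
        V′ j = sum λ i → v (suc i) j
        V j = v₀ j + V′ j
        eig₀ : ∀ x → ⟨ x , Δ w v₀ ⟩ ≈ α₀ * ⟨ x , v₀ ⟩
        eig₀ x = trans (⟨⟩-cong {n} (λ _ → refl) (eig zero)) (⟨⟩-*ʳ {n} α₀ x v₀)

    δ : Fin n → Vector Carrier n
    δ i j = if does (i Fin.≟ j) then 1# else 0#

    δ-diag : ∀ i → δ i i ≈ 1#
    δ-diag i with i Fin.≟ i
    ... | yes _ = refl
    ... | no i≢i = contradiction ≡.refl i≢i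

    δ-off : ∀ {i j} → i ≢ j → δ i j ≈ 0#
    δ-off {i} {j} i≢j with i Fin.≟ j
    ... | yes i≡j = contradiction i≡j i≢j
    ... | no _ = refl

    ∑-δ : ∀ i (x : Vector Carrier n) → (sum λ j → δ i j * x j) ≈ x i
    ∑-δ i x = trans (∑-single {n} _ i λ j i≢j → trans (*-congʳ (δ-off i≢j)) (zeroˡ (x j)))
      (trans (*-congʳ (δ-diag i)) (*-identityˡ (x i)))

    comb : Vector Carrier n → Vector (Vector Carrier n) n → Vector Carrier n
    comb c b j = sum λ i → c i * b i j

    comb-linear : ∀ s t c d b j → comb (λ i → s * c i + t * d i) b j ≈ s * comb c b j + t * comb d b j
    comb-linear s t c d b j = begin
      comb (λ i → s * c i + t * d i) b j
        ≈⟨ ∑-cong {n} (λ i → solve 5 (λ s t c d b → (s :* c :+ t :* d) :* b := s :* (c :* b) :+ t :* (d :* b))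
             refl s t (c i) (d i) (b i j)) ⟩
      sum (λ i → s * (c i * b i j) + t * (d i * b i j))
        ≈⟨ ∑-distrib-+ {n} _ _ ⟩
      sum (λ i → s * (c i * b i j)) + sum (λ i → t * (d i * b i j))
        ≈⟨ +-cong (*-distribˡ-sum {n} s _) (*-distribˡ-sum {n} t _) ⟨
      s * comb c b j + t * comb d b j ∎
      where open ≈-Reasoning

    Δ-∑ : ∀ w {m} (v : Vector (Vector Carrier n) m) u →
      Δ w (λ j → sum λ i → v i j) u ≈ sum λ i → Δ w (v i) u
    Δ-∑ w {zero}  v u = Δ-const w 0# u
    Δ-∑ w {suc m} v u = trans (Δ-+ w (v zero) _ u) (+-congˡ (Δ-∑ w (λ i → v (suc i)) u))

  -- A spectrum in the sense of IsSpectrum, for a weighted graph Laplacian.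
  record Eigenbasis {n} (w : Weights n) (∂ : Vector Carrier n) : Set where
    field
      w-sym       : ∀ u v → w u v ≈ w v u
      ∂-antitone  : ∀ {i j} → i Fin.≤ j → ∂ j ≤ ∂ i
      b           : Vector (Vector Carrier n) n
      independent : ∀ c → (∀ j → comb c b j ≈ 0#) → ∀ i → c i ≈ 0#
      coords      : Vector Carrier n → Vector Carrier n
      coords-comb : ∀ x j → x j ≈ comb (coords x) b j
      eigen       : ∀ i j → Δ w (b i) j ≈ ∂ i * b i j

  -- Eigenvalue bounds from an eigenbasis.

  module EigenbasisProperties {n} {w : Weights n} {∂ : Vector Carrier n} (B : Eigenbasis w ∂) where
    open Eigenbasis B
    open Symmetric w w-sym

    -- Each `b i` scaled by its coordinate is still an eigenvector, so `x` is a sum of eigenvectors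
    -- and `rayleigh` applies.
    energy-≤ : ∀ {a} → (∀ i → ∂ i ≤ a) → ∀ x → energy w x ≤ a * ⟨ x , x ⟩
    energy-≤ {a} ∂≤a x = begin
      energy w x             ≈⟨ energy-cong w (coords-comb x) ⟩
      energy w (comb c b)    ≤⟨ rayleigh ∂ (λ i j → c i * b i j) ∂≤a ∂-antitone eigen′ ⟩
      a * ⟨ comb c b , comb c b ⟩ ≈⟨ *-congˡ (⟨⟩-cong {n} (coords-comb x) (coords-comb x)) ⟨
      a * ⟨ x , x ⟩          ∎
      where
      open ≤-Reasoning
      c = coords x
      eigen′ : ∀ i j → Δ w (λ k → c i * b i k) j ≈ ∂ i * (c i * b i j)
      eigen′ i j = trans (Δ-* w (c i) (b i) j) (trans (*-congˡ (eigen i j))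
        (solve 3 (λ c d b → c :* (d :* b) := d :* (c :* b)) refl (c i) (∂ i) (b i j)))

    comb-δ : ∀ i j → comb (δ i) b j ≈ b i j
    comb-δ i j = ∑-δ i (λ k → b k j)

    b≢0 : ∀ i → ¬ (⟨ b i , b i ⟩ ≤ 0#)
    b≢0 i h = 1≰0 (≤-reflexive (trans (sym (δ-diag i))
      (independent (δ i) (λ j → trans (comb-δ i j) (⟨x,x⟩≤0⇒x≈0 (b i) h j)) i)))

    energy-b : ∀ i → energy w (b i) ≈ ∂ i * ⟨ b i , b i ⟩
    energy-b i = trans (⟨⟩-cong {n} (λ _ → refl) (eigen i)) (⟨⟩-*ʳ {n} (∂ i) (b i) (b i))

    ∂-≤ : ∀ {r} → (∀ x → energy w x ≤ r * ⟨ x , x ⟩) → ∀ i → ∂ i ≤ r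
    ∂-≤ h i = *-cancelʳ-≤ (b≢0 i) (≤-trans (≤-reflexive (sym (energy-b i))) (h (b i)))

    Δ-comb : ∀ c j → Δ w (comb c b) j ≈ comb (λ i → c i * ∂ i) b j
    Δ-comb c j = trans (Δ-∑ w (λ i k → c i * b i k) j) (∑-cong {n} λ i →
      trans (Δ-* w (c i) (b i) j) (trans (*-congˡ (eigen i j)) (sym (*-assoc (c i) (∂ i) (b i j)))))

    -- Some combination of b p and b l is orthogonal to the constants.
    ≤-∂ : ∀ {r} → (∀ x → sum x ≈ 0# → r * ⟨ x , x ⟩ ≤ energy w x) →
      ∀ {p l} → p Fin.≤ l → p ≢ l → r ≤ ∂ p
    ≤-∂ {r} h {p} {l} p≤l p≢l = ≤-stable λ r≰∂p →
      -- If `z` is nonzero, it is the test vector. If it vanishes, independence makes its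
      -- coefficient at `b l` vanish; that coefficient is `- sum (b p)`, so `b p` is itself
      -- orthogonal to the constants and serves as test vector.
      let z≤0 : ⟨ z , z ⟩ ≤ 0#
          z≤0 = ≤-stable λ z≰0 → r≰∂p (*-cancelʳ-≤ z≰0 (≤-trans (h z ∑z≈0) energy-z))
          σp≈0 : - sum (b p) ≈ 0#
          σp≈0 = trans (sym coeff-l) (independent coeff
            (λ j → trans (comb-coeff j) (⟨x,x⟩≤0⇒x≈0 z z≤0 j)) l)
          ∑b≈0 : sum (b p) ≈ 0#
          ∑b≈0 = trans (solve 1 (λ x → x := :- (:- x)) refl _)
            (trans (-‿cong σp≈0) (solve 0 (:- con ℤ.0ℤ := con ℤ.0ℤ) refl))
      in r≰∂p (*-cancelʳ-≤ (b≢0 p) (≤-trans (h (b p) ∑b≈0) (≤-reflexive (energy-b p))))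
      where
      s t : Carrier
      s = sum (b l)
      t = - sum (b p)
      coeff : Vector Carrier n
      coeff i = s * δ p i + t * δ l i
      z : Vector Carrier n
      -- The trailing `0#` makes `z` definitionally the sum over `Fin 2` to which `rayleigh` is
      -- applied.
      z j = s * b p j + (t * b l j + 0#)
      comb-coeff : ∀ j → comb coeff b j ≈ z j
      comb-coeff j = trans (comb-linear s t (δ p) (δ l) b j)
        (+-cong (*-congˡ (comb-δ p j)) (trans (*-congˡ (comb-δ l j)) (sym (+-identityʳ _))))
      coeff-l : coeff l ≈ t
      coeff-l = trans (+-cong (*-congˡ (δ-off p≢l)) (*-congˡ (δ-diag l)))
        (solve 2 (λ s t → s :* con ℤ.0ℤ :+ t :* con ℤ.1ℤ := t) refl s t)
      ∑z≈0 : sum z ≈ 0#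
      ∑z≈0 = begin
        sum z  ≈⟨ trans (∑-distrib-+ {n} _ _) (+-congˡ (∑-cong {n} λ _ → +-identityʳ _)) ⟩
        sum (λ j → s * b p j) + sum (λ j → t * b l j)
               ≈⟨ +-cong (*-distribˡ-sum {n} s (b p)) (*-distribˡ-sum {n} t (b l)) ⟨
        sum (b l) * sum (b p) + - sum (b p) * sum (b l)
               ≈⟨ solve 2 (λ x y → x :* y :+ (:- y) :* x := con ℤ.0ℤ) refl (sum (b l)) (sum (b p)) ⟩
        0#     ∎
        where open ≈-Reasoning
      α : Vector Carrier 2
      α zero    = ∂ p
      α (suc _) = ∂ l
      v : Vector (Vector Carrier n) 2
      v zero    j = s * b p j
      v (suc _) j = t * b l j
      scaled : ∀ c i j → Δ w (λ k → c * b i k) j ≈ ∂ i * (c * b i j)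
      scaled c i j = trans (Δ-* w c (b i) j) (trans (*-congˡ (eigen i j))
        (solve 3 (λ c d b → c :* (d :* b) := d :* (c :* b)) refl c (∂ i) (b i j)))
      energy-z : energy w z ≤ ∂ p * ⟨ z , z ⟩
      energy-z = rayleigh α v
        (λ { zero → ≤-refl ; (suc _) → ∂-antitone p≤l })
        (λ { {zero} {zero} _ → ≤-refl ; {zero} {suc _} _ → ∂-antitone p≤l ; {suc _} {suc _} _ → ≤-refl })
        (λ { zero → scaled s p ; (suc _) → scaled t l })

    -- The vectors with Δ x = r x + const that are spanned by the constants and χ
    -- would otherwise all be multiples of b l.
    ∂-≤-of-cut : ∀ {p l} → (∀ i → i Fin.≤ p ⊎ i ≡ l) → ∀ {r a} → 0# ≤ r → ∀ {χ : Vector Carrier n} →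
      (∀ u → Δ w χ u ≈ r * χ u + a) → ∀ {u v} → χ u ≈ 1# → χ v ≈ 0# → ∂ p ≤ r
    ∂-≤-of-cut {p} {l} cover {r} {a} 0≤r {χ} Δχ {u} {v} χu≈1 χv≈0 = ≤-stable λ ∂p≰r →
      -- Coordinates of `Δ 𝟙 = 0` and `Δ χ = r χ + a` give `d i * ∂ i ≈ 0#` and
      -- `c i * (∂ i - r) ≈ a * d i`. If `∂ p` exceeds `r`, which is nonnegative, then `∂ i` and
      -- `∂ i - r` can be cancelled for all `i` up to `p`: first `d i`, then `c i` vanishes.
      let ∂≰r : ∀ {i} → i Fin.≤ p → ¬ (∂ i ≤ r)
          ∂≰r i≤p ∂i≤r = ∂p≰r (≤-trans (∂-antitone i≤p) ∂i≤r)
          d≈0 : ∀ {i} → i Fin.≤ p → d i ≈ 0#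
          d≈0 {i} i≤p = *-cancelʳ-≈0 (λ ∂i≤0 → ∂≰r i≤p (≤-trans ∂i≤0 0≤r)) (d∂≈0 i)
          c≈0 : ∀ {i} → i Fin.≤ p → c i ≈ 0#
          c≈0 {i} i≤p = *-cancelʳ-≈0 (λ h → ∂≰r i≤p (x-y≤0⇒x≤y h))
            (trans (solve 5 (λ c d q r a →
                 c :* (q :- r) := (con ℤ.1ℤ :* (c :* q) :+ (:- con ℤ.1ℤ) :* (r :* c :+ a :* d)) :+ a :* d)
                 refl (c i) (d i) (∂ i) r a)
              (trans (+-cong (relation i) (trans (*-congˡ (d≈0 i≤p)) (zeroʳ a))) (+-identityˡ 0#)))
          e≈0 : ∀ i → e i ≈ 0#
          e≈0 i = [ (λ i≤p → trans (+-cong (trans (*-congˡ (c≈0 i≤p)) (zeroʳ _))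
                                         (trans (*-congˡ (d≈0 i≤p)) (zeroʳ _))) (+-identityˡ 0#))
                  , (λ { ≡.refl → solve 2 (λ c d → d :* c :+ (:- c) :* d := con ℤ.0ℤ) refl (c l) (d l) })
                  ]′ (cover i)
          e-comb : ∀ j → d l * χ j - c l ≈ 0#
          e-comb j = begin
            d l * χ j - c l                          ≈⟨ +-congˡ (*-identityʳ _) ⟨
            d l * χ j + - c l * 1#
              ≈⟨ +-cong (*-congˡ (coords-comb χ j)) (*-congˡ (coords-comb 𝟙 j)) ⟩
            d l * comb c b j + - c l * comb d b j    ≈⟨ comb-linear _ _ c d b j ⟨
            comb e b j                               ≈⟨ ∑-zero {n} (λ i → trans (*-congʳ (e≈0 i)) (zeroˡ _)) ⟩
            0#                                       ∎
          -- `d l * χ` is the constant `c l`, whereas `χ` takes both values 1 and 0. Then all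
          -- coordinates of `𝟙` vanish, which is absurd.
          dl≈0 : d l ≈ 0#
          dl≈0 = begin
            d l
              ≈⟨ solve 2 (λ c d → d := (d :* con ℤ.1ℤ :- c) :- (d :* con ℤ.0ℤ :- c)) refl (c l) (d l) ⟩
            (d l * 1# - c l) - (d l * 0# - c l)
              ≈⟨ +-cong (+-congʳ (*-congˡ χu≈1)) (-‿cong (+-congʳ (*-congˡ χv≈0))) ⟨
            (d l * χ u - c l) - (d l * χ v - c l)
              ≈⟨ +-cong (e-comb u) (-‿cong (e-comb v)) ⟩
            0# - 0#
              ≈⟨ -‿inverseʳ 0# ⟩
            0# ∎
          d≈0′ : ∀ i → d i ≈ 0#
          d≈0′ i = [ d≈0 , (λ { ≡.refl → dl≈0 }) ]′ (cover i)
      in 1≰0 (≤-reflexive (trans (coords-comb 𝟙 u)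
           (∑-zero {n} λ i → trans (*-congʳ (d≈0′ i)) (zeroˡ _))))
      where
      open ≈-Reasoning
      𝟙 c d e : Vector Carrier n
      𝟙 _ = 1#
      c = coords χ
      d = coords 𝟙
      -- Coordinates of `d l * χ - c l * 𝟙`, the combination that cancels at `l`.
      e i = d l * c i + - c l * d i
      d∂≈0 : ∀ i → d i * ∂ i ≈ 0#
      d∂≈0 = independent _ λ j → begin
        comb (λ i → d i * ∂ i) b j  ≈⟨ Δ-comb d j ⟨
        Δ w (comb d b) j            ≈⟨ Δ-cong w (coords-comb 𝟙) j ⟨
        Δ w 𝟙 j                     ≈⟨ Δ-const w 1# j ⟩
        0#                          ∎
      relation : ∀ i → 1# * (c i * ∂ i) + - 1# * (r * c i + a * d i) ≈ 0#
      relation = independent _ λ j → begin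
        comb (λ i → 1# * (c i * ∂ i) + - 1# * (r * c i + a * d i)) b j
          ≈⟨ trans (comb-linear _ _ (λ i → c i * ∂ i) (λ i → r * c i + a * d i) b j)
               (+-cong (*-congˡ (sym (Δ-comb c j))) (*-congˡ (comb-linear r a c d b j))) ⟩
        1# * Δ w (comb c b) j + - 1# * (r * comb c b j + a * comb d b j)
          ≈⟨ +-cong (*-congˡ (Δ-cong w (coords-comb χ) j))
               (*-congˡ (+-cong (*-congˡ (coords-comb χ j)) (*-congˡ (coords-comb 𝟙 j)))) ⟨
        1# * Δ w χ j + - 1# * (r * χ j + a * 1#)
          ≈⟨ +-congʳ (*-congˡ (Δχ j)) ⟩
        1# * (r * χ j + a) + - 1# * (r * χ j + a * 1#)
          ≈⟨ solve 3 (λ r x a →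
                 con ℤ.1ℤ :* (r :* x :+ a) :+ (:- con ℤ.1ℤ) :* (r :* x :+ a :* con ℤ.1ℤ) := con ℤ.0ℤ)
               refl r (χ j) a ⟩
        0# ∎

  -- Laplacians with weights `1 + E`.

  -- The distances of a graph of diameter at most 2, with E the adjacency matrix of its
  -- complement, agree off the diagonal with w.
  module OnePlus {n} (E : Weights n) where

    w : Weights n
    w u v = 1# + E u v

    -- The constant weights contribute the Laplacian of the complete graph, n I - J, which
    -- multiplies vectors of sum zero by n.
    Δ-1+E : ∀ x u → Δ w x u ≈ (# n * x u - sum x) + Δ E x u
    Δ-1+E x u = begin
      Δ w x u
        ≈⟨ ∑-cong {n} (λ v → solve 3 (λ e a b → (con ℤ.1ℤ :+ e) :* (a :- b) := (a :- b) :+ e :* (a :- b))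
             refl (E u v) (x u) (x v)) ⟩
      sum (λ v → (x u - x v) + E u v * (x u - x v))
        ≈⟨ ∑-distrib-+ {n} _ _ ⟩
      sum (λ v → x u - x v) + Δ E x u
        ≈⟨ +-congʳ (trans (∑-distrib-- {n} (λ _ → x u) x) (+-congʳ (∑-const n (x u)))) ⟩
      (# n * x u - sum x) + Δ E x u ∎
      where open ≈-Reasoning

    energy-1+E : ∀ x → energy w x ≈ (# n * ⟨ x , x ⟩ - sum x * sum x) + energy E x
    energy-1+E x = begin
      energy w x
        ≈⟨ ⟨⟩-cong {n} (λ _ → refl) (Δ-1+E x) ⟩
      ⟨ x , (λ u → (# n * x u - sum x) + Δ E x u) ⟩
        ≈⟨ ⟨⟩-+ʳ {n} _ _ x ⟩
      ⟨ x , (λ u → # n * x u - sum x) ⟩ + energy E x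
        ≈⟨ +-congʳ (trans (⟨⟩-+ʳ {n} _ _ x) (+-cong (⟨⟩-*ʳ {n} (# n) x x)
             (trans (sym (*-distribʳ-sum {n} _ x)) (solve 1 (λ s → s :* (:- s) := :- (s :* s)) refl (sum x))))) ⟩
      (# n * ⟨ x , x ⟩ - sum x * sum x) + energy E x ∎
      where open ≈-Reasoning

    energy-sum0 : ∀ x → sum x ≈ 0# → energy w x ≈ # n * ⟨ x , x ⟩ + energy E x
    energy-sum0 x ∑x≈0 = trans (energy-1+E x) (+-congʳ (trans
      (+-congˡ (-‿cong (trans (*-congʳ ∑x≈0) (zeroˡ (sum x)))))
      (solve 1 (λ x → x :- con ℤ.0ℤ := x) refl _)))

    module _ (E-sym : ∀ u v → E u v ≈ E v u) (0≤E : ∀ u v → 0# ≤ E u v) where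
      open Symmetric E E-sym

      energy-E-nonneg : ∀ x → 0# ≤ energy E x
      energy-E-nonneg x = double-cancel-≤ (≤-trans (≤-reflexive (+-identityˡ 0#))
        (≤-trans (∑-nonneg {n} λ u → ∑-nonneg {n} λ v → *-nonneg (0≤E u v) (0≤x² _))
          (≤-reflexive (sym (energy-+ x)))))

      energy-≥ : ∀ x → sum x ≈ 0# → # n * ⟨ x , x ⟩ ≤ energy w x
      energy-≥ x ∑x≈0 = begin
        # n * ⟨ x , x ⟩               ≈⟨ +-identityʳ _ ⟨
        # n * ⟨ x , x ⟩ + 0#          ≤⟨ +-mono-≤ ≤-refl (energy-E-nonneg x) ⟩
        # n * ⟨ x , x ⟩ + energy E x  ≈⟨ energy-sum0 x ∑x≈0 ⟨
        energy w x                    ∎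
        where open ≤-Reasoning

    -- Test vector: the degree of u at u, and -1 at its neighbours.
    module Star (E-sym : ∀ u v → E u v ≈ E v u) (E-01 : ∀ u v → E u v ≈ 0# ⊎ E u v ≈ 1#)
      (E-irrefl : ∀ u → E u u ≈ 0#) (u : Fin n) where
      open Symmetric E E-sym

      e k : Carrier
      e = sum (E u)
      k = (e + 1#) * (e + 1#)

      star : Vector Carrier n
      star v = δ u v * e - E u v

      E²≈E : ∀ v → E u v * E u v ≈ E u v
      E²≈E v with E-01 u v
      ... | inj₁ h = trans (*-congˡ h) (trans (zeroʳ _) (sym h))
      ... | inj₂ h = trans (*-congˡ h) (*-identityʳ _)

      ∑-star : sum star ≈ 0#
      ∑-star = trans (∑-distrib-- {n} _ _) (trans (+-congʳ (∑-δ u (λ _ → e))) (-‿inverseʳ e))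

      ⟨star,star⟩ : ⟨ star , star ⟩ ≈ e * (e + 1#)
      ⟨star,star⟩ = begin
        sum (λ v → star v * star v)
          -- The square is expanded with a factor `δ u v` in front, so that `∑-δ` evaluates that
          -- part at `u`; the remaining `E u v * E u v` is `E u v`, its values being 0 and 1.
          ≈⟨ ∑-cong {n} (λ v → trans
               (solve 3 (λ d e f → (d :* e :- f) :* (d :* e :- f) :=
                   d :* (d :* (e :* e) :- con (ℤ.+ 2) :* (e :* f)) :+ f :* f)
                 refl (δ u v) e (E u v))
               (+-congˡ (E²≈E v))) ⟩
        sum (λ v → δ u v * (δ u v * (e * e) - ι (ℤ.+ 2) * (e * E u v)) + E u v)
          ≈⟨ trans (∑-distrib-+ {n} _ _) (+-congʳ (∑-δ u _)) ⟩
        (δ u u * (e * e) - ι (ℤ.+ 2) * (e * E u u)) + e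
          ≈⟨ +-congʳ (+-cong (*-congʳ (δ-diag u)) (-‿cong (*-congˡ (*-congˡ (E-irrefl u))))) ⟩
        (1# * (e * e) - ι (ℤ.+ 2) * (e * 0#)) + e
          ≈⟨ solve 1 (λ e → (con ℤ.1ℤ :* (e :* e) :- con (ℤ.+ 2) :* (e :* con ℤ.0ℤ)) :+ e :=
               e :* (e :+ con ℤ.1ℤ)) refl e ⟩
        e * (e + 1#) ∎
        where open ≈-Reasoning

      -- `g` is the summand of the Dirichlet form of `star`, and `f` symmetrised is its part on the
      -- edges at `u`. Along such an edge `star` drops from `e` to `- 1#`, whence `k = (e + 1#)²`;
      -- all other edges contribute nonnegative terms, which are discarded.
      f g : Weights n
      f v w = δ u v * (E u w * k)
      g v w = E v w * ((star v - star w) * (star v - star w))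

      ∑∑-f : ∑∑ f ≈ e * k
      ∑∑-f = begin
        ∑∑ f  ≈⟨ ∑-cong {n} (λ v → *-distribˡ-sum {n} (δ u v) _) ⟨
        sum (λ v → δ u v * sum (λ w → E u w * k))  ≈⟨ ∑-δ u _ ⟩
        sum (λ w → E u w * k)  ≈⟨ *-distribʳ-sum {n} k (E u) ⟨
        e * k ∎
        where open ≈-Reasoning

      0≤E : ∀ v w → 0# ≤ E v w
      0≤E v w with E-01 v w
      ... | inj₁ h = ≤-reflexive (sym h)
      ... | inj₂ h = ≤-trans (≰⇒≥ 1≰0) (≤-reflexive (sym h))

      0≤g : ∀ v w → 0# ≤ g v w
      0≤g v w = *-nonneg (0≤E v w) (0≤x² _)

      f-centre : ∀ w → f u w ≈ E u w * k
      f-centre w = trans (*-congʳ (δ-diag u)) (*-identityˡ _)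

      f-off : ∀ {v} w → u ≢ v → f v w ≈ 0#
      f-off w u≢v = trans (*-congʳ (δ-off u≢v)) (zeroˡ _)

      f≤g-centre : ∀ {w} → u ≢ w → f u w + f w u ≤ g u w
      f≤g-centre {w} u≢w with E-01 u w
      ... | inj₁ h = ≤-trans (≤-reflexive (trans
          (+-cong (trans (f-centre w) (trans (*-congʳ h) (zeroˡ k))) (f-off u u≢w))
          (+-identityˡ 0#))) (0≤g u w)
      ... | inj₂ h = ≤-reflexive (trans (+-cong (f-centre w) (f-off u u≢w)) (trans (+-identityʳ _)
          (*-congˡ (*-cong e+1 e+1))))
        where
        e+1 : e + 1# ≈ star u - star w
        e+1 = begin
          e + 1#
            ≈⟨ solve 1 (λ e → e :+ con ℤ.1ℤ :=
                 (con ℤ.1ℤ :* e :- con ℤ.0ℤ) :- (con ℤ.0ℤ :* e :- con ℤ.1ℤ)) refl e ⟩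
          (1# * e - 0#) - (0# * e - 1#)
            ≈⟨ +-cong (+-cong (*-congʳ (δ-diag u)) (-‿cong (E-irrefl u)))
                 (-‿cong (+-cong (*-congʳ (δ-off u≢w)) (-‿cong h))) ⟨
          star u - star w ∎
          where open ≈-Reasoning

      f≤g : ∀ v w → f v w + f w v ≤ g v w
      f≤g v w = compare v w (u Fin.≟ v) (u Fin.≟ w)
        where
        compare : ∀ v w → Dec (u ≡ v) → Dec (u ≡ w) → f v w + f w v ≤ g v w
        compare v w (yes ≡.refl) (no u≢w) = f≤g-centre u≢w
        compare v w (no u≢v) (yes ≡.refl) = ≤-trans (≤-reflexive (+-comm _ _))
          (≤-trans (f≤g-centre u≢v) (≤-reflexive (*-cong (E-sym u v)
            (solve 2 (λ a b → (a :- b) :* (a :- b) := (b :- a) :* (b :- a)) refl _ _))))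
        compare v w (no u≢v) (no u≢w) = ≤-trans
          (≤-reflexive (trans (+-cong (f-off w u≢v) (f-off v u≢w)) (+-identityˡ 0#))) (0≤g v w)
        compare v w (yes ≡.refl) (yes ≡.refl) = ≤-trans
          (≤-reflexive (trans (+-cong f≈0 f≈0) (+-identityˡ 0#))) (0≤g u u)
          where f≈0 = trans (f-centre u) (trans (*-congʳ (E-irrefl u)) (zeroˡ k))

      energy-star : e * k ≤ energy E star
      energy-star = double-cancel-≤ (begin
        e * k + e * k                      ≈⟨ +-cong ∑∑-f (trans (∑-comm {n} {n} (λ v w → f w v)) ∑∑-f) ⟨
        ∑∑ f + ∑∑ (λ v w → f w v)          ≈⟨ ∑∑-+ f (λ v w → f w v) ⟨
        ∑∑ (λ v w → f v w + f w v)         ≤⟨ ∑-mono-≤ {n} (λ v → ∑-mono-≤ {n} (f≤g v)) ⟩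
        ∑∑ g                               ≈⟨ energy-+ star ⟨
        energy E star + energy E star      ∎)
        where open ≤-Reasoning

      -- The quotient of `star` with respect to `E` is at least e(e + 1)² / e(e + 1) = e + 1.
      -- Positivity of `e` allows the squared length to be cancelled.
      degree-≤ : ¬ (e ≤ 0#) → ∀ {r} → (∀ x → energy w x ≤ r * ⟨ x , x ⟩) → # n + (e + 1#) ≤ r
      degree-≤ e≰0 {r} h = *-cancelʳ-≤ e[e+1]≰0 (begin
        (# n + (e + 1#)) * (e * (e + 1#))
          ≈⟨ solve 3 (λ n e o → (n :+ (e :+ o)) :* (e :* (e :+ o)) :=
                 n :* (e :* (e :+ o)) :+ e :* ((e :+ o) :* (e :+ o)))
               refl (# n) e 1# ⟩
        # n * (e * (e + 1#)) + e * k      ≤⟨ +-mono-≤ (≤-reflexive (*-congˡ (sym ⟨star,star⟩))) energy-star ⟩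
        # n * ⟨ star , star ⟩ + energy E star ≈⟨ energy-sum0 star ∑-star ⟨
        energy w star                     ≤⟨ h star ⟩
        r * ⟨ star , star ⟩               ≈⟨ *-congˡ ⟨star,star⟩ ⟩
        r * (e * (e + 1#))                ∎)
        where
        open ≤-Reasoning
        e≤e+1 : e ≤ e + 1#
        e≤e+1 = ≤-trans (≤-reflexive (sym (+-identityʳ e))) (+-mono-≤ ≤-refl (≰⇒≥ 1≰0))
        e[e+1]≰0 : ¬ (e * (e + 1#) ≤ 0#)
        e[e+1]≰0 h = e≰0 (*-cancelʳ-≤0 (λ e+1≤0 → e≰0 (≤-trans e≤e+1 e+1≤0)) h)

    -- The diagonal of E does not enter Δ, so E may be replaced by a block matrix of ones.
    energy-≤-blocks : ∀ {k} (p : Fin k → Vector Carrier n) {s} →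
      (∀ {u v} → u ≢ v → E u v ≈ sum λ i → p i u * p i v) →
      (∀ u → (sum λ v → sum λ i → p i u * p i v) ≈ s) →
      ∀ x → energy w x ≤ (# n + s) * ⟨ x , x ⟩
    energy-≤-blocks {k} p {s} E≈P row x = begin
      energy w x
        ≈⟨ energy-1+E x ⟩
      (# n * ⟨ x , x ⟩ - sum x * sum x) + energy E x
        ≈⟨ +-congˡ energy-E ⟩
      (# n * ⟨ x , x ⟩ - sum x * sum x) + (s * ⟨ x , x ⟩ - sum σ²)
        ≈⟨ solve 5 (λ n s q a b → (n :* q :- a) :+ (s :* q :- b) := (n :+ s) :* q :- (a :+ b))
             refl (# n) s ⟨ x , x ⟩ (sum x * sum x) (sum σ²) ⟩
      (# n + s) * ⟨ x , x ⟩ - (sum x * sum x + sum σ²)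
        -- What is subtracted is a sum of squares: of the total `sum x` and of the block sums `σ i`.
        ≤⟨ +-mono-≤ ≤-refl (neg-≤0 (≤-trans (≤-reflexive (sym (+-identityˡ 0#)))
             (+-mono-≤ (0≤x² (sum x)) (∑-nonneg {k} λ i → 0≤x² (σ i))))) ⟩
      (# n + s) * ⟨ x , x ⟩ + 0#
        ≈⟨ +-identityʳ _ ⟩
      (# n + s) * ⟨ x , x ⟩ ∎
      where
      open ≤-Reasoning
      P : Weights n
      P u v = sum λ i → p i u * p i v
      σ σ² : Vector Carrier k
      σ i = ⟨ p i , x ⟩
      σ² i = σ i * σ i
      Δ-E : ∀ u → Δ E x u ≈ Δ P x u
      Δ-E u = ∑-cong {n} λ v → term v (u Fin.≟ v)
        where
        term : ∀ v → Dec (u ≡ v) → E u v * (x u - x v) ≈ P u v * (x u - x v)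
        term v (yes ≡.refl) = trans (*-congˡ (-‿inverseʳ (x u)))
          (trans (zeroʳ _) (sym (trans (*-congˡ (-‿inverseʳ (x u))) (zeroʳ _))))
        term v (no u≢v) = *-congʳ (E≈P u≢v)
      P-row : ∀ u → sum (λ v → P u v * x v) ≈ sum λ i → p i u * σ i
      P-row u = begin-equality
        sum (λ v → P u v * x v)                     ≈⟨ ∑-cong {n} (λ v → *-distribʳ-sum {k} (x v) _) ⟩
        sum (λ v → sum λ i → p i u * p i v * x v)   ≈⟨ ∑-comm {n} {k} _ ⟩
        sum (λ i → sum λ v → p i u * p i v * x v)   ≈⟨ ∑-cong {k} (λ i → trans (∑-cong {n} λ v → *-assoc _ _ _)
                                                         (sym (*-distribˡ-sum {n} (p i u) _))) ⟩
        sum (λ i → p i u * σ i)                     ∎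
      Δ-P : ∀ u → Δ P x u ≈ s * x u - sum λ i → p i u * σ i
      Δ-P u = begin-equality
        Δ P x u
          ≈⟨ ∑-cong {n} (λ v → solve 3 (λ p a b → p :* (a :- b) := p :* a :- p :* b) refl (P u v) (x u) (x v)) ⟩
        sum (λ v → P u v * x u - P u v * x v)
          ≈⟨ ∑-distrib-- {n} _ _ ⟩
        sum (λ v → P u v * x u) - sum (λ v → P u v * x v)
          ≈⟨ +-cong (trans (sym (*-distribʳ-sum {n} (x u) _)) (*-congʳ (row u))) (-‿cong (P-row u)) ⟩
        s * x u - sum (λ i → p i u * σ i) ∎
      energy-E : energy E x ≈ s * ⟨ x , x ⟩ - sum σ²
      energy-E = begin-equality
        energy E x
          ≈⟨ ∑-cong {n} (λ u → *-congˡ (trans (Δ-E u) (Δ-P u))) ⟩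
        sum (λ u → x u * (s * x u - sum λ i → p i u * σ i))
          ≈⟨ ∑-cong {n} (λ u → solve 3 (λ x s q → x :* (s :* x :- q) := x :* (s :* x) :- x :* q) refl (x u) s _) ⟩
        sum (λ u → x u * (s * x u) - x u * sum λ i → p i u * σ i)
          ≈⟨ trans (∑-distrib-- {n} _ _) (+-cong (⟨⟩-*ʳ {n} s x x) (-‿cong cross)) ⟩
        s * ⟨ x , x ⟩ - sum σ² ∎
        where
        cross : (sum λ u → x u * sum λ i → p i u * σ i) ≈ sum σ²
        cross = begin-equality
          sum (λ u → x u * sum λ i → p i u * σ i)    ≈⟨ ∑-cong {n} (λ u → *-distribˡ-sum {k} (x u) _) ⟩
          sum (λ u → sum λ i → x u * (p i u * σ i))  ≈⟨ ∑-comm {n} {k} _ ⟩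
          sum (λ i → sum λ u → x u * (p i u * σ i))
            ≈⟨ ∑-cong {k} (λ i → trans (∑-cong {n} λ u →
                   solve 3 (λ x p s → x :* (p :* s) := p :* x :* s) refl (x u) (p i u) (σ i))
                 (sym (*-distribʳ-sum {n} (σ i) _))) ⟩
          sum σ² ∎

  -- The distance Laplacian of a graph with disconnected complement.

  module DistanceLaplacian {n : ℕ} (G : Graph n) (conn : Connected G)
    (disconnected : ¬ Connected (complement G)) where
    E : Weights n
    E u v = # (coadj G u v)

    open OnePlus E

    E-sym : ∀ u v → E u v ≈ E v u
    E-sym u v = reflexive (≡.cong # (coadj-sym G u v))

    -- The counterpart of `distanceLaplacian` over the abstract ring. `eigenbasis` accepts any `M`
    -- with entries `≈` to these, so over the reals only the sequences of the entries have to be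
    -- compared.
    matrix : Weights n
    matrix u v = (if does (u Fin.≟ v) then # (transmission G conn u) else 0#) - # (dist G conn u v)

    #-sum : ∀ {m} (f : Fin m → ℕ) → # (sumℕ f) ≈ sum λ i → # (f i)
    #-sum {zero}  f = ι-0
    #-sum {suc m} f = trans (#-+ (f zero) _) (+-congˡ (#-sum (λ i → f (suc i))))

    -- The diagonal holds the row sums of the distances, so the matrix acts as the Laplacian with
    -- distances as weights. A diagonal weight multiplies `x u - x u`, so `1 + E` may replace the
    -- distances even where it differs from them.
    matrix-Δ : ∀ x u → (sum λ v → matrix u v * x v) ≈ Δ w x u
    matrix-Δ x u = begin
      sum (λ v → matrix u v * x v)
        ≈⟨ ∑-cong {n} (λ v → solve 3 (λ t d x → (t :- d) :* x := t :* x :- d :* x) refl (T v) (D v) (x v)) ⟩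
      sum (λ v → T v * x v - D v * x v)
        ≈⟨ ∑-distrib-- {n} _ _ ⟩
      sum (λ v → T v * x v) - sum (λ v → D v * x v)
        ≈⟨ +-congʳ (trans (∑-single {n} _ u λ v u≢v → trans (*-congʳ (T-off v (u Fin.≟ v) u≢v)) (zeroˡ (x v)))
             (*-congʳ (T-diag (u Fin.≟ u)))) ⟩
      # (transmission G conn u) * x u - sum (λ v → D v * x v)
        -- `transmission` sums over the first argument of `dist`, the row over the second.
        ≈⟨ +-congʳ (*-congʳ (trans (#-sum {n} _)
             (∑-cong {n} λ v → reflexive (≡.cong # (dist-sym G disconnected conn v u))))) ⟩
      sum D * x u - sum (λ v → D v * x v)
        ≈⟨ +-congʳ (*-distribʳ-sum {n} (x u) D) ⟩
      sum (λ v → D v * x u) - sum (λ v → D v * x v)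
        ≈⟨ ∑-distrib-- {n} _ _ ⟨
      sum (λ v → D v * x u - D v * x v)
        ≈⟨ ∑-cong {n} (λ v → entry v (u Fin.≟ v)) ⟩
      Δ w x u ∎
      where
      open ≈-Reasoning
      T D : Vector Carrier n
      T v = if does (u Fin.≟ v) then # (transmission G conn u) else 0#
      D v = # (dist G conn u v)
      T-off : ∀ v (u≟v : Dec (u ≡ v)) → u ≢ v → (if does u≟v then # (transmission G conn u) else 0#) ≈ 0#
      T-off v (yes u≡v) u≢v = contradiction u≡v u≢v
      T-off v (no _) _ = refl
      T-diag : (u≟u : Dec (u ≡ u)) →
        (if does u≟u then # (transmission G conn u) else 0#) ≈ # (transmission G conn u)
      T-diag (yes _) = refl
      T-diag (no u≢u) = contradiction ≡.refl u≢u
      entry : ∀ v → Dec (u ≡ v) → D v * x u - D v * x v ≈ w u v * (x u - x v)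
      entry v (yes ≡.refl) = solve 3 (λ d w x → d :* x :- d :* x := w :* (x :- x)) refl (D u) (w u u) (x u)
      entry v (no u≢v) = trans
        (solve 3 (λ d x y → d :* x :- d :* y := d :* (x :- y)) refl (D v) (x u) (x v))
        (*-congʳ (trans (reflexive (≡.cong # (dist-≢ G disconnected conn u≢v))) (#-suc (coadj G u v))))

    eigenvector-Δ : ∀ {M : Weights n} {a} {x : Vector Carrier n} → (∀ u v → M u v ≈ matrix u v) →
      (∀ u → (sum λ v → M u v * x v) ≈ a * x u) → ∀ u → Δ w x u ≈ a * x u
    eigenvector-Δ {M} {a} {x} M≈ eigen u =
      trans (sym (trans (∑-cong {n} λ v → *-congʳ (M≈ u v)) (matrix-Δ x u))) (eigen u)

    eigenbasis : ∀ {∂ : Vector Carrier n} {M : Weights n} →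
      (∀ u v → M u v ≈ matrix u v) →
      (∀ {i j} → i Fin.≤ j → ∂ j ≤ ∂ i) → (b : Vector (Vector Carrier n) n) →
      (∀ c → (∀ j → (sum λ i → c i * b i j) ≈ 0#) → ∀ i → c i ≈ 0#) →
      (∀ (x : Vector Carrier n) → ∃[ c ] ∀ j → x j ≈ sum λ i → c i * b i j) →
      (∀ i j → (sum λ v → M j v * b i v) ≈ ∂ i * b i j) →
      Eigenbasis w ∂
    eigenbasis M≈ ∂-antitone b independent spanning eigen = record
      { w-sym       = λ u v → +-congˡ (E-sym u v)
      ; ∂-antitone  = ∂-antitone
      ; b           = b
      ; independent = independent
      ; coords      = λ x → proj₁ (spanning x)
      ; coords-comb = λ x → proj₂ (spanning x)
      ; eigen       = λ i → eigenvector-Δ M≈ (eigen i)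
      }

    largest-≥ : ∀ {∂} → Eigenbasis w ∂ → ∀ {a} → (∀ i → ∂ i ≤ a) →
      ∀ u → 1 ℕ.≤ codegree G u → # n + # (suc (codegree G u)) ≤ a
    largest-≥ B {a} ∂≤a u 1≤d = ≤-trans
      (≤-reflexive (+-congˡ (trans (#-suc (codegree G u)) (trans (+-comm _ _) (+-congʳ (#-sum (coadj G u)))))))
      (degree-≤ e≰0 (EigenbasisProperties.energy-≤ B ∂≤a))
      where
      E-01 : ∀ u v → E u v ≈ 0# ⊎ E u v ≈ 1#
      E-01 u v with coadj G u v | 𝟏-01 (Graph._~?_ (complement G) u v)
      ... | _ | inj₁ ≡.refl = inj₁ ι-0
      ... | _ | inj₂ ≡.refl = inj₂ ι-1
      open Star E-sym E-01 (λ u → trans (reflexive (≡.cong # (coadj-irrefl G u))) ι-0) u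
      e≰0 : ¬ (sum (E u) ≤ 0#)
      e≰0 h = ℕ.n≮0 {0} (#-cancel-≤ (≤-trans (#-mono-≤ 1≤d) (≤-trans (≤-reflexive (#-sum (coadj G u)))
        (≤-trans h (≤-reflexive (sym ι-0))))))

    -- No edge of the complement crosses a cut, so its Laplacian kills the indicator `χ` of a side.
    -- This leaves Δ χ = n χ - sum χ, an eigenvector equation up to a constant.
    second-smallest-≤ : ∀ {∂} → Eigenbasis w ∂ → ∀ {p l} → (∀ i → i Fin.≤ p ⊎ i ≡ l) → ∂ p ≤ # n
    second-smallest-≤ B cover = ≤-stable λ ∂p≰n → ¬¬cut G disconnected λ cut → ∂p≰n (from-cut cut)
      where
      open EigenbasisProperties B
      from-cut : Cut G disconnected → _
      from-cut cut = ∂-≤-of-cut cover (0≤# n) {χ = χ} Δχ (χ-in (proj₂ inside)) (χ-out (proj₂ outside))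
        where
        open Cut cut
        χ : Vector Carrier n
        χ v = # (𝟏 (side? v))
        χ-in : ∀ {v} → Side v → χ v ≈ 1#
        χ-in {v} s = trans (reflexive (≡.cong # (𝟏-yes (side? v) s))) ι-1
        χ-out : ∀ {v} → ¬ Side v → χ v ≈ 0#
        χ-out {v} ¬s = trans (reflexive (≡.cong # (𝟏-no (side? v) ¬s))) ι-0
        ΔE≈0 : ∀ u → Δ E χ u ≈ 0#
        ΔE≈0 u = ∑-zero {n} λ v → term v (Graph._~?_ (complement G) u v)
          where
          term : ∀ v → Dec (Graph._~_ (complement G) u v) → E u v * (χ u - χ v) ≈ 0#
          term v (yes u≁v) = trans (*-congˡ (trans (+-congʳ χu≈χv) (-‿inverseʳ (χ v)))) (zeroʳ _)
            where
            χu≈χv : χ u ≈ χ v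
            χu≈χv = reflexive (≡.cong # (𝟏-cong (side? u) (side? v)
              (closed u≁v) (closed (Graph.~-sym (complement G) u≁v))))
          term v (no h) = trans (*-congʳ (trans
            (reflexive (≡.cong # (𝟏-no (Graph._~?_ (complement G) u v) h))) ι-0)) (zeroˡ _)
        Δχ : ∀ u → Δ w χ u ≈ # n * χ u + - sum χ
        Δχ u = trans (Δ-1+E χ u) (trans (+-congˡ (ΔE≈0 u)) (+-identityʳ _))

    -- The complement is a disjoint union of cliques on the classes. With `p i` the indicator of
    -- class `i`, `E` agrees off the diagonal with the block matrix of ones, whose row sums are the
    -- class sizes.
    energy-≤-balanced : ∀ {k s} {c : Fin n → Fin k} → IsKPartition G c →
      (∀ {u v} → c u ≢ c v → Graph._~_ G u v) → (∀ i → classSize G c i ≡ s) →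
      ∀ x → energy w x ≤ (# n + # s) * ⟨ x , x ⟩
    energy-≤-balanced {k} {s} {c} (_ , proper) complete size = energy-≤-blocks {k} p E≈P row
      where
      p : Fin k → Vector Carrier n
      p i u = # (𝟏 (c u Fin.≟ i))
      P≈p : ∀ u v → (sum λ i → p i u * p i v) ≈ p (c u) v
      P≈p u v = trans
        (∑-single {k} _ (c u) λ i cu≢i → trans (*-congʳ (trans
          (reflexive (≡.cong # (𝟏-no (c u Fin.≟ i) cu≢i))) ι-0)) (zeroˡ _))
        (trans (*-congʳ (trans (reflexive (≡.cong # (𝟏-yes (c u Fin.≟ c u) ≡.refl))) ι-1)) (*-identityˡ _))
      E≈P : ∀ {u v} → u ≢ v → E u v ≈ sum λ i → p i u * p i v
      E≈P {u} {v} u≢v = trans (reflexive (≡.cong # (𝟏-cong (Graph._~?_ (complement G) u v) (c v Fin.≟ c u)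
          nonadjacent⇒≡ (λ cv≡cu → u≢v , λ u~v → proper u~v (≡.sym cv≡cu)))))
        (sym (P≈p u v))
        where
        nonadjacent⇒≡ : Graph._~_ (complement G) u v → c v ≡ c u
        nonadjacent⇒≡ (_ , u≁v) with c v Fin.≟ c u
        ... | yes cv≡cu = cv≡cu
        ... | no cv≢cu = contradiction (complete (cv≢cu ∘ ≡.sym)) u≁v
      row : ∀ u → (sum λ v → sum λ i → p i u * p i v) ≈ # s
      row u = trans (∑-cong {n} (P≈p u)) (trans (sym (#-sum {n} _))
        (reflexive (≡.cong # (≡.trans (≡.sym (classSize-sum G c (c u))) (size (c u))))))

  -- The spread: lower bound and equality case.

  module Spread {m : ℕ} (G : Graph (suc (suc m))) (conn : Connected G)
    (disconnected : ¬ Connected (complement G)) where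
    private
      n : ℕ
      n = suc (suc m)

    module _ {∂} (B : Eigenbasis (OnePlus.w (DistanceLaplacian.E G conn disconnected)) ∂)
      {DLS : Carrier} (DLS≈ : DLS ≈ ∂ zero - ∂ (opposite (suc zero))) where
      open Eigenbasis B using (∂-antitone)

      1+codegree≤spread : ∀ u → 1 ℕ.≤ codegree G u → # (suc (codegree G u)) ≤ DLS
      1+codegree≤spread u 1≤d = begin
        d                                  ≈⟨ solve 2 (λ n d → d := (n :+ d) :- n) refl (# n) d ⟩
        (# n + d) - # n                    ≤⟨ +-mono-≤ ∂₁≥ (neg-mono-≤ ∂ₙ₋₁≤) ⟩
        ∂ zero - ∂ (opposite (suc zero))   ≈⟨ DLS≈ ⟨
        DLS                                ∎
        where
        open ≤-Reasoning
        d = # (suc (codegree G u))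
        ∂₁≥ : # n + d ≤ ∂ zero
        ∂₁≥ = DistanceLaplacian.largest-≥ G conn disconnected B
          (λ i → ∂-antitone {j = i} z≤n) u 1≤d
        ∂ₙ₋₁≤ : ∂ (opposite (suc zero)) ≤ # n
        ∂ₙ₋₁≤ = DistanceLaplacian.second-smallest-≤ G conn disconnected B second-to-last-cover

      module _ {k} .{{_ : ℕ.NonZero k}} (k<n : k ℕ.< n) where
        private
          s : ℕ
          s = n / k

        spread-≤⇒balanced : ∀ {c : Fin n → Fin k} → IsKPartition G c → DLS ≤ # s →
          (∀ i → classSize G c i ≡ s) × (∀ {u v} → c u ≢ c v → Graph._~_ G u v) × n ≡ s ℕ.* k
        spread-≤⇒balanced c-partition DLS≤s =
          balanced-of-codegree-≤ G c-partition (ℕ.<⇒≤ k<n) λ u 1≤d →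
            #-cancel-≤ (≤-trans (1+codegree≤spread u 1≤d) DLS≤s)

        balanced⇒spread-≤ : BalancedCompleteKPartite G k → DLS ≤ # s
        balanced⇒spread-≤ (c , c-partition , complete , equal) = begin
          DLS                               ≈⟨ DLS≈ ⟩
          ∂ zero - ∂ (opposite (suc zero))  ≤⟨ +-mono-≤ ∂₁≤ (neg-mono-≤ ∂ₙ₋₁≥) ⟩
          (# n + # s) - # n                 ≈⟨ solve 2 (λ n s → (n :+ s) :- n := s) refl (# n) (# s) ⟩
          # s                               ∎
          where
          open ≤-Reasoning
          ∂₁≤ : ∂ zero ≤ # n + # s
          ∂₁≤ = EigenbasisProperties.∂-≤ B (DistanceLaplacian.energy-≤-balanced G conn disconnected
            c-partition complete (balanced-classSize G c equal)) zero
          ∂ₙ₋₁≥ : # n ≤ ∂ (opposite (suc zero))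
          ∂ₙ₋₁≥ = EigenbasisProperties.≤-∂ B
            (OnePlus.energy-≥ (DistanceLaplacian.E G conn disconnected)
              (DistanceLaplacian.E-sym G conn disconnected) (λ u v → 0≤# (coadj G u v)))
            second-to-last≤last second-to-last≢last

        module _ (kPartite : KPartite G k) where
          private
            c-partition = proj₂ kPartite

          spread-≥ : # s ≤ DLS
          spread-≥ = ≤-stable λ s≰DLS →
            let size , _ , n≡sk = spread-≤⇒balanced c-partition (≰⇒≥ s≰DLS)
                s≤1+d = ≡.subst (ℕ._≤ suc (codegree G zero)) (size (proj₁ kPartite zero))
                          (classSize≤1+codegree G c-partition zero)
                -- `n ≡ s * k` and `k < n` exclude `s ≤ 1`. For `k = n` the graph would be complete,
                -- with spread 0.
                2≤s = ℕ.≰⇒> λ s≤1 → ℕ.<⇒≱ k<n (≡.subst₂ ℕ._≤_ (≡.sym n≡sk) (ℕ.*-identityˡ k)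
                        (ℕ.*-monoˡ-≤ k s≤1))
                1≤d = ℕ.≤-pred (ℕ.≤-trans 2≤s s≤1+d)
            in s≰DLS (≤-trans (#-mono-≤ s≤1+d) (1+codegree≤spread zero 1≤d))

          spread-≈ : DLS ≈ # s ⇔ (n % k ≡ 0 × BalancedCompleteKPartite G k)
          spread-≈ = mk⇔
            (λ DLS≈s →
              let size , complete , n≡sk = spread-≤⇒balanced c-partition (≤-reflexive DLS≈s) in
              ≡.trans (≡.cong (_% k) n≡sk) (m*n%n≡0 s k) ,
              proj₁ kPartite , c-partition , (λ {u} {v} → complete {u} {v}) ,
              λ i j → ≡.trans (size i) (≡.sym (size j)))
            (λ (_ , balanced) → ≤-antisym (balanced⇒spread-≤ balanced) spread-≥)

-- The Cauchy reals as an ordered ring.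

module Reals where
  open Defs
  open import Algebra.Definitions _≈_ using (Inverse; Congruent₁)
  open ≡ using (refl; sym; trans; cong; cong₂; subst; subst₂)

  Eventually : (ℕ → Set) → Set
  Eventually P = ∃[ N ] ∀ m → N ℕ.≤ m → P m

  eventually₂ : ∀ {P Q R : ℕ → Set} → (∀ m → P m → Q m → R m) →
    Eventually P → Eventually Q → Eventually R
  eventually₂ f (M , p) (N , q) = M ℕ.⊔ N , λ m ≤m →
    f m (p m (ℕ.m⊔n≤o⇒m≤o M N ≤m)) (q m (ℕ.m⊔n≤o⇒n≤o M N ≤m))

  halve : ∀ {ε} → 0ℚ ℚ.< ε → ∃[ η ] 0ℚ ℚ.< η × η ℚ.+ η ≡ ε
  halve {ε} 0<ε = ½ ℚ.* ε , ε/2>0 0<ε , ε/2+ε/2 ε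

  module _ where
    open +-*-Solver

    -- With it, a comparison becomes a sum of the hypotheses together with one identity for the ring
    -- solver.
    <-shift : ∀ {p q r s} → p ℚ.< q → s ℚ.- r ≡ q ℚ.- p → r ℚ.< s
    <-shift {p} {q} {r} {s} p<q eq = subst₂ ℚ._<_
      (solve 2 (λ p r → p :+ (r :- p) := r) refl p r)
      (trans (solve 3 (λ p q r → q :+ (r :- p) := (q :- p) :+ r) refl p q r)
        (trans (cong (ℚ._+ r) (sym eq)) (solve 2 (λ r s → (s :- r) :+ r := s) refl r s)))
      (ℚ.+-monoˡ-< (r ℚ.- p) p<q)

    p≤∣p∣ : ∀ p → p ℚ.≤ ℚ.∣ p ∣
    p≤∣p∣ p with ℚ.≤-total 0ℚ p
    ... | inj₁ 0≤p = ℚ.≤-reflexive (sym (ℚ.0≤p⇒∣p∣≡p 0≤p))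
    ... | inj₂ p≤0 = ℚ.≤-trans p≤0 (ℚ.0≤∣p∣ p)

    ∣p-q∣<ε⇒p<q+ε : ∀ p q {ε} → ℚ.∣ p ℚ.- q ∣ ℚ.< ε → p ℚ.< q ℚ.+ ε
    ∣p-q∣<ε⇒p<q+ε p q {ε} h = <-shift (ℚ.≤-<-trans (p≤∣p∣ (p ℚ.- q)) h)
      (solve 3 (λ p q ε → (q :+ ε) :- p := ε :- (p :- q)) refl p q ε)

    ∣p-q∣<ε⇒q<p+ε : ∀ p q {ε} → ℚ.∣ p ℚ.- q ∣ ℚ.< ε → q ℚ.< p ℚ.+ ε
    ∣p-q∣<ε⇒q<p+ε p q h = ∣p-q∣<ε⇒p<q+ε q p (subst (ℚ._< _)
      (trans (sym (ℚ.∣-p∣≡∣p∣ (p ℚ.- q)))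
        (cong ℚ.∣_∣ (solve 2 (λ p q → :- (p :- q) := q :- p) refl p q))) h)

    ∣p-q∣<ε : ∀ p q {ε} → p ℚ.< q ℚ.+ ε → q ℚ.< p ℚ.+ ε → ℚ.∣ p ℚ.- q ∣ ℚ.< ε
    ∣p-q∣<ε p q {ε} p<q+ε q<p+ε with ℚ.∣p∣≡p∨∣p∣≡-p (p ℚ.- q)
    ... | inj₁ eq = subst (ℚ._< ε) (sym eq) (<-shift p<q+ε
      (solve 3 (λ p q ε → ε :- (p :- q) := (q :+ ε) :- p) refl p q ε))
    ... | inj₂ eq = subst (ℚ._< ε) (sym eq) (<-shift q<p+ε
      (solve 3 (λ p q ε → ε :- (:- (p :- q)) := (p :+ ε) :- q) refl p q ε))

    ≤-reflexive : ∀ {x y} → x ≈ y → x ≤ y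
    ≤-reflexive {x} {y} x≈y = mk≤ λ ε 0<ε →
      let N , h = ≈-eventually x≈y ε 0<ε in
      N , λ m N≤m → ∣p-q∣<ε⇒p<q+ε (seq x m) (seq y m) (h m N≤m)

    ≤-antisym : ∀ {x y} → x ≤ y → y ≤ x → x ≈ y
    ≤-antisym {x} {y} x≤y y≤x = mk≈ λ ε 0<ε →
      eventually₂ (λ m → ∣p-q∣<ε (seq x m) (seq y m)) (≤-eventually x≤y ε 0<ε) (≤-eventually y≤x ε 0<ε)

    ≤-trans : ∀ {x y z} → x ≤ y → y ≤ z → x ≤ z
    ≤-trans {x} {y} {z} x≤y y≤z = mk≤ λ ε 0<ε → go ε (halve 0<ε)
      where
      go : ∀ ε → ∃[ η ] 0ℚ ℚ.< η × η ℚ.+ η ≡ ε → Eventually λ m → seq x m ℚ.< seq z m ℚ.+ ε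
      go _ (η , 0<η , refl) = eventually₂ (λ m x<y y<z → <-shift (ℚ.+-mono-< x<y y<z)
        (solve 4 (λ x y z η → (z :+ (η :+ η)) :- x := ((y :+ η) :+ (z :+ η)) :- (x :+ y))
          refl (seq x m) (seq y m) (seq z m) η))
        (≤-eventually x≤y η 0<η) (≤-eventually y≤z η 0<η)

    +-mono-≤ : ∀ {x y u v} → x ≤ y → u ≤ v → x + u ≤ y + v
    +-mono-≤ {x} {y} {u} {v} x≤y u≤v = mk≤ λ ε 0<ε → go ε (halve 0<ε)
      where
      go : ∀ ε → ∃[ η ] 0ℚ ℚ.< η × η ℚ.+ η ≡ ε →
        Eventually λ m → seq x m ℚ.+ seq u m ℚ.< seq y m ℚ.+ seq v m ℚ.+ ε
      go _ (η , 0<η , refl) = eventually₂ (λ m x<y u<v → <-shift (ℚ.+-mono-< x<y u<v)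
        (solve 5 (λ x y u v η → (y :+ v :+ (η :+ η)) :- (x :+ u) := ((y :+ η) :+ (v :+ η)) :- (x :+ u))
          refl (seq x m) (seq y m) (seq u m) (seq v m) η))
        (≤-eventually x≤y η 0<η) (≤-eventually u≤v η 0<η)

    neg-mono-≤ : ∀ {x y} → x ≤ y → - y ≤ - x
    neg-mono-≤ {x} {y} x≤y = mk≤ λ ε 0<ε →
      let N , h = ≤-eventually x≤y ε 0<ε in N , λ m N≤m → <-shift (h m N≤m)
        (solve 3 (λ x y ε → (:- x :+ ε) :- (:- y) := (y :+ ε) :- x) refl (seq x m) (seq y m) ε)

  ≈-pointwise : ∀ {x y} → (∀ m → seq x m ≡ seq y m) → x ≈ y
  ≈-pointwise {x} {y} x≡y = mk≈ λ ε 0<ε → 0 , λ m _ →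
    subst (ℚ._< ε) (sym (cong ℚ.∣_∣ (trans (cong (ℚ._- seq y m) (x≡y m)) (ℚ.+-inverseʳ (seq y m))))) 0<ε

  ≈-refl : ∀ {x} → x ≈ x
  ≈-refl {x} = ≈-pointwise λ _ → refl

  ≤-refl : ∀ {x} → x ≤ x
  ≤-refl = ≤-reflexive ≈-refl

  ≈-sym : ∀ {x y} → x ≈ y → y ≈ x
  ≈-sym {x} {y} x≈y = mk≈ λ ε 0<ε → let N , h = ≈-eventually x≈y ε 0<ε in
    N , λ m N≤m → ∣p-q∣<ε (seq y m) (seq x m)
      (∣p-q∣<ε⇒q<p+ε (seq x m) (seq y m) (h m N≤m)) (∣p-q∣<ε⇒p<q+ε (seq x m) (seq y m) (h m N≤m))

  ≈-trans : ∀ {x y z} → x ≈ y → y ≈ z → x ≈ z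
  ≈-trans x≈y y≈z = ≤-antisym (≤-trans (≤-reflexive x≈y) (≤-reflexive y≈z))
    (≤-trans (≤-reflexive (≈-sym y≈z)) (≤-reflexive (≈-sym x≈y)))

  +-cong : ∀ {x y u v} → x ≈ y → u ≈ v → x + u ≈ y + v
  +-cong {x} {y} {u} {v} x≈y u≈v = ≤-antisym
    (+-mono-≤ {x} {y} {u} {v} (≤-reflexive x≈y) (≤-reflexive u≈v))
    (+-mono-≤ {y} {x} {v} {u} (≤-reflexive (≈-sym x≈y)) (≤-reflexive (≈-sym u≈v)))

  -‿cong : ∀ {x y} → x ≈ y → - x ≈ - y
  -‿cong x≈y = ≤-antisym (neg-mono-≤ (≤-reflexive (≈-sym x≈y))) (neg-mono-≤ (≤-reflexive x≈y))

  *-cong : ∀ {x y u v} → x ≈ y → u ≈ v → x * u ≈ y * v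
  *-cong {x} {y} {u} {v} x≈y u≈v = mk≈ λ ε 0<ε →
    let A , A>0 , K , xA = bounded (seq x) (cauchy x)
        B , B>0 , L , vB = bounded (seq v) (cauchy v)
        α , 0<α , Aα = tolerance A A>0 ε 0<ε
        β , 0<β , Bβ = tolerance B B>0 ε 0<ε
    in eventually₂ (λ m (p , q) (r , s) →
         *-close (seq x m) (seq u m) (seq y m) (seq v m) (A , A>0) (B , B>0) Aα Bβ p q r s)
         (eventually₂ (λ _ → _,_) (K , xA) (L , vB))
         (eventually₂ (λ _ → _,_) (≈-eventually x≈y β 0<β) (≈-eventually u≈v α 0<α))

  1ℝ : ℝ
  1ℝ = fromℚ 1ℚ

  +-assoc : ∀ x y z → (x + y) + z ≈ x + (y + z)
  +-assoc x y z = ≈-pointwise λ m → ℚ.+-assoc (seq x m) (seq y m) (seq z m)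

  +-comm : ∀ x y → x + y ≈ y + x
  +-comm x y = ≈-pointwise λ m → ℚ.+-comm (seq x m) (seq y m)

  +-identityˡ : ∀ x → 0ℝ + x ≈ x
  +-identityˡ x = ≈-pointwise λ m → ℚ.+-identityˡ (seq x m)

  +-inverseˡ : ∀ x → - x + x ≈ 0ℝ
  +-inverseˡ x = ≈-pointwise λ m → ℚ.+-inverseˡ (seq x m)

  *-assoc : ∀ x y z → (x * y) * z ≈ x * (y * z)
  *-assoc x y z = ≈-pointwise λ m → ℚ.*-assoc (seq x m) (seq y m) (seq z m)

  *-comm : ∀ x y → x * y ≈ y * x
  *-comm x y = ≈-pointwise λ m → ℚ.*-comm (seq x m) (seq y m)

  *-identityˡ : ∀ x → 1ℝ * x ≈ x
  *-identityˡ x = ≈-pointwise λ m → ℚ.*-identityˡ (seq x m)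

  *-distribʳ-+ : ∀ x y z → (y + z) * x ≈ y * x + z * x
  *-distribʳ-+ x y z = ≈-pointwise λ m → ℚ.*-distribʳ-+ (seq x m) (seq y m) (seq z m)

  ≈-isEquivalence : IsEquivalence _≈_
  ≈-isEquivalence = record { refl = ≈-refl ; sym = ≈-sym ; trans = ≈-trans }

  +-identityʳ : ∀ x → x + 0ℝ ≈ x
  +-identityʳ x = ≈-pointwise λ m → ℚ.+-identityʳ (seq x m)

  +-inverseʳ : ∀ x → x + - x ≈ 0ℝ
  +-inverseʳ x = ≈-pointwise λ m → ℚ.+-inverseʳ (seq x m)

  *-identityʳ : ∀ x → x * 1ℝ ≈ x
  *-identityʳ x = ≈-pointwise λ m → ℚ.*-identityʳ (seq x m)

  *-distribˡ-+ : ∀ x y z → x * (y + z) ≈ x * y + x * z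
  *-distribˡ-+ x y z = ≈-pointwise λ m → ℚ.*-distribˡ-+ (seq x m) (seq y m) (seq z m)

  +-inverse : Inverse 0ℝ (-_) _+_
  +-inverse = +-inverseˡ , +-inverseʳ

  -- Stated for a variable f: at f = -_ Agda would compare the Cauchy moduli of two forms
  -- of - x.
  congruent₁ : ∀ {f : ℝ → ℝ} → (∀ {x y} → x ≈ y → f x ≈ f y) → Congruent₁ f
  congruent₁ f-cong = f-cong

  -‿congruent : Congruent₁ (-_)
  -‿congruent = congruent₁ { -_ } λ {x} {y} → -‿cong {x} {y}

  +-isMonoid : IsMonoid _≈_ _+_ 0ℝ
  +-isMonoid = record
    { isSemigroup = record
      { isMagma = record
        { isEquivalence = ≈-isEquivalence ; ∙-cong = λ {x} {y} {u} {v} → +-cong {x} {y} {u} {v} }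
      ; assoc = +-assoc }
    ; identity = +-identityˡ , +-identityʳ }

  +-isGroup : IsGroup _≈_ _+_ 0ℝ (-_)
  +-isGroup = record { isMonoid = +-isMonoid ; inverse = +-inverse ; ⁻¹-cong = -‿congruent }

  +-isAbelianGroup : IsAbelianGroup _≈_ _+_ 0ℝ (-_)
  +-isAbelianGroup = record { isGroup = +-isGroup ; comm = +-comm }

  +-*-isRing : IsRing _≈_ _+_ _*_ (-_) 0ℝ 1ℝ
  +-*-isRing = record
    { +-isAbelianGroup = +-isAbelianGroup
    ; *-cong = λ {x} {y} {u} {v} → *-cong {x} {y} {u} {v}
    ; *-assoc = *-assoc
    ; *-identity = *-identityˡ , *-identityʳ
    ; distrib = *-distribˡ-+ , *-distribʳ-+ }

  ℝ-commutativeRing : CommutativeRing 0ℓ 0ℓ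
  ℝ-commutativeRing = record
    { isCommutativeRing = record { isRing = +-*-isRing ; *-comm = *-comm } }

  -- A positive lower bound on x - y, the constructive content of y < x.
  Above : ℝ → ℝ → Set
  Above x y = ∃[ δ ] 0ℚ ℚ.< δ × Eventually λ m → seq y m ℚ.+ δ ℚ.≤ seq x m

  module _ where
    open +-*-Solver

    above⇒≥ : ∀ {x y} → Above x y → y ≤ x
    above⇒≥ {x} {y} (δ , 0<δ , N , h) = mk≤ λ ε 0<ε → N , λ m N≤m →
      <-shift (ℚ.+-mono-≤-< (h m N≤m) (ℚ.+-mono-< 0<δ 0<ε))
        (solve 4 (λ x y δ ε → (x :+ ε) :- y := (x :+ (δ :+ ε)) :- (y :+ δ :+ con 0ℚ))
          refl (seq x m) (seq y m) δ ε)

    above⇒≰ : ∀ {x y} → Above x y → ¬ (x ≤ y)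
    above⇒≰ (δ , 0<δ , h) x≤y with N , f ← eventually₂ (λ m → _,_) h (≤-eventually x≤y δ 0<δ) =
      ℚ.<-irrefl refl (ℚ.<-≤-trans (proj₂ (f N ℕ.≤-refl)) (proj₁ (f N ℕ.≤-refl)))

    -- Compare the two sequences at an index from which both vary by less than ε / 8.
    ¬above⇒≤ : ∀ {x y} → ¬ Above x y → x ≤ y
    ¬above⇒≤ {x} {y} ¬a = mk≤ λ ε 0<ε → go ε (halve 0<ε)
      where
      module _ {η} (0<η : 0ℚ ℚ.< η) {K}
        (near : ∀ m → K ℕ.≤ m →
          ℚ.∣ seq x m ℚ.- seq x K ∣ ℚ.< η × ℚ.∣ seq y m ℚ.- seq y K ∣ ℚ.< η) where
        -- The threshold `4η` leaves room on both sides. Below it, later terms satisfy x < y + 6η,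
        -- and two more `η` make up ε = 8η; from it on, later terms keep x above y + 2η, a gap that
        -- witnesses `Above x y`.
        compare : Dec (seq x K ℚ.< seq y K ℚ.+ ((η ℚ.+ η) ℚ.+ (η ℚ.+ η))) →
          ∀ m → K ℕ.≤ m → seq x m ℚ.< seq y m ℚ.+ (((η ℚ.+ η) ℚ.+ (η ℚ.+ η)) ℚ.+ ((η ℚ.+ η) ℚ.+ (η ℚ.+ η)))
        compare (yes x<y) m K≤m = <-shift
          (ℚ.+-mono-< (ℚ.+-mono-< x<y (ℚ.+-mono-< 0<η 0<η)) (ℚ.+-mono-<
            (∣p-q∣<ε⇒p<q+ε (seq x m) (seq x K) (proj₁ (near m K≤m)))
            (∣p-q∣<ε⇒q<p+ε (seq y m) (seq y K) (proj₂ (near m K≤m)))))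
          (solve 5 (λ x y u v η →
              (y :+ (((η :+ η) :+ (η :+ η)) :+ ((η :+ η) :+ (η :+ η)))) :- x :=
              (((v :+ ((η :+ η) :+ (η :+ η))) :+ (η :+ η)) :+ ((u :+ η) :+ (y :+ η))) :-
                ((u :+ con 0ℚ) :+ (x :+ v)))
            refl (seq x m) (seq y m) (seq x K) (seq y K) η)
        compare (no x≮y) _ _ = contradiction (η ℚ.+ η , ℚ.+-mono-< 0<η 0<η , K , λ m K≤m →
          ℚ.<⇒≤ (<-shift
            (ℚ.+-mono-≤-< (ℚ.≮⇒≥ x≮y) (ℚ.+-mono-<
              (∣p-q∣<ε⇒q<p+ε (seq x m) (seq x K) (proj₁ (near m K≤m)))
              (∣p-q∣<ε⇒p<q+ε (seq y m) (seq y K) (proj₂ (near m K≤m)))))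
            (solve 5 (λ x y u v η → x :- (y :+ (η :+ η)) :=
                (u :+ ((x :+ η) :+ (v :+ η))) :-
                  ((v :+ ((η :+ η) :+ (η :+ η))) :+ (u :+ y)))
              refl (seq x m) (seq y m) (seq x K) (seq y K) η))) ¬a
      go : ∀ ε → ∃[ η ] 0ℚ ℚ.< η × η ℚ.+ η ≡ ε → Eventually λ m → seq x m ℚ.< seq y m ℚ.+ ε
      go _ (_ , 0<η₄ , refl) with halve 0<η₄
      ... | _ , 0<η₂ , refl with halve 0<η₂
      ...   | η , 0<η , refl with cauchy x η 0<η | cauchy y η 0<η
      ...     | M , hx | N , hy = M ℕ.⊔ N ,
        compare 0<η (λ m ≤m →
          hx m (M ℕ.⊔ N) (ℕ.≤-trans (ℕ.m≤m⊔n M N) ≤m) (ℕ.m≤m⊔n M N) ,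
          hy m (M ℕ.⊔ N) (ℕ.≤-trans (ℕ.m≤n⊔m M N) ≤m) (ℕ.m≤n⊔m M N))
          (seq x (M ℕ.⊔ N) ℚ.<? _)

  -- `x ≤ y` is equivalent to `¬ Above x y`, and negations are stable.
  ≤-stable : ∀ {x y} → ¬ ¬ (x ≤ y) → x ≤ y
  ≤-stable ¬¬x≤y = ¬above⇒≤ λ a → ¬¬x≤y (above⇒≰ a)

  ≰⇒≥ : ∀ {x y} → ¬ (x ≤ y) → y ≤ x
  ≰⇒≥ x≰y = ≤-stable λ y≰x → x≰y (¬above⇒≤ λ a → y≰x (above⇒≥ a))

  -- Where `t` is at least `δ`, a term of `x` at least `ε` would give a product at least `ε * δ`;
  -- hence the tolerance `ε * δ` in the hypothesis.
  *-cancel-above : ∀ {x t} → Above t 0ℝ → x * t ≤ 0ℝ → x ≤ 0ℝ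
  *-cancel-above {x} {t} (δ , 0<δ , T) xt≤0 = mk≤ λ ε 0<ε →
    eventually₂ (λ m δ≤t xt<εδ → ℚ.≰⇒> λ ε≤x →
        ℚ.<-irrefl refl (ℚ.<-≤-trans xt<εδ (bound ε 0<ε m δ≤t ε≤x))) T
      (≤-eventually xt≤0 (ε ℚ.* δ) (pos* 0<ε 0<δ))
    where
    pos* : ∀ {ε} → 0ℚ ℚ.< ε → 0ℚ ℚ.< δ → 0ℚ ℚ.< ε ℚ.* δ
    pos* {ε} 0<ε 0<δ = ℚ.positive⁻¹ (ε ℚ.* δ)
      {{ℚ.pos*pos⇒pos ε {{ℚ.positive 0<ε}} δ {{ℚ.positive 0<δ}}}}
    bound : ∀ ε → 0ℚ ℚ.< ε → ∀ m → 0ℚ ℚ.+ δ ℚ.≤ seq t m → 0ℚ ℚ.+ ε ℚ.≤ seq x m →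
      0ℚ ℚ.+ ε ℚ.* δ ℚ.≤ seq x m ℚ.* seq t m
    bound ε 0<ε m δ≤t ε≤x = begin
      0ℚ ℚ.+ ε ℚ.* δ     ≡⟨ ℚ.+-identityˡ (ε ℚ.* δ) ⟩
      ε ℚ.* δ            ≤⟨ ℚ.*-monoˡ-≤-nonNeg ε {{ℚ.pos⇒nonNeg ε {{ℚ.positive 0<ε}}}}
                              (subst (ℚ._≤ seq t m) (ℚ.+-identityˡ δ) δ≤t) ⟩
      ε ℚ.* seq t m      ≤⟨ ℚ.*-monoʳ-≤-nonNeg (seq t m) {{ℚ.nonNegative 0≤t}}
                              (subst (ℚ._≤ seq x m) (ℚ.+-identityˡ ε) ε≤x) ⟩
      seq x m ℚ.* seq t m ∎
      where
      open ℚ.≤-Reasoning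
      0≤t = ℚ.≤-trans (ℚ.<⇒≤ 0<δ) (subst (ℚ._≤ seq t m) (ℚ.+-identityˡ δ) δ≤t)

  -- `¬ (t ≤ 0ℝ)` yields a positive gap for `t` only up to double negation, which suffices for a
  -- stable conclusion.
  *-cancelʳ-≤0 : ∀ {x t} → ¬ (t ≤ 0ℝ) → x * t ≤ 0ℝ → x ≤ 0ℝ
  *-cancelʳ-≤0 {x} {t} t≰0 xt≤0 = ≤-stable λ x≰0 →
    t≰0 (¬above⇒≤ λ a → x≰0 (*-cancel-above {x} {t} a xt≤0))

  1≰0 : ¬ (1ℝ ≤ 0ℝ)
  1≰0 = above⇒≰ (1ℚ , ℚ.positive⁻¹ 1ℚ , 0 , λ _ _ → ℚ.≤-refl)

  fromℤ : ℤ.ℤ → ℝ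
  fromℤ i = fromℚ (i ℚ./ 1)

  module _ where
    -- `i ℚ./ 1` is normalised by a gcd, which is stuck for a variable `i`; among unnormalised
    -- fractions the homomorphism laws reduce to integer identities.
    /1-via-ℚᵘ : ∀ {p} i → ℚ.toℚᵘ p ℚᵘ.≃ ℚᵘ.mkℚᵘ i 0 → i ℚ./ 1 ≡ p
    /1-via-ℚᵘ i h = ℚ.toℚᵘ-injective (ℚᵘ.≃-trans (ℚ.toℚᵘ-fromℚᵘ (ℚᵘ.mkℚᵘ i 0)) (ℚᵘ.≃-sym h))

    toℚᵘ-/1 : ∀ i → ℚ.toℚᵘ (i ℚ./ 1) ℚᵘ.≃ ℚᵘ.mkℚᵘ i 0
    toℚᵘ-/1 i = ℚ.toℚᵘ-fromℚᵘ (ℚᵘ.mkℚᵘ i 0)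

    fromℤ-+ : ∀ i j → fromℤ (i ℤ.+ j) ≈ fromℤ i + fromℤ j
    fromℤ-+ i j = ≈-pointwise λ _ → /1-via-ℚᵘ (i ℤ.+ j) (ℚᵘ.≃-trans (ℚ.toℚᵘ-homo-+ (i ℚ./ 1) (j ℚ./ 1))
      (ℚᵘ.≃-trans (ℚᵘ.+-cong (toℚᵘ-/1 i) (toℚᵘ-/1 j))
        (ℚᵘ.*≡* (cong (ℤ._* ℤ.1ℤ) (cong₂ ℤ._+_ (ℤ.*-identityʳ i) (ℤ.*-identityʳ j))))))

    fromℤ-* : ∀ i j → fromℤ (i ℤ.* j) ≈ fromℤ i * fromℤ j
    fromℤ-* i j = ≈-pointwise λ _ → /1-via-ℚᵘ (i ℤ.* j) (ℚᵘ.≃-trans (ℚ.toℚᵘ-homo-* (i ℚ./ 1) (j ℚ./ 1))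
      (ℚᵘ.*-cong (toℚᵘ-/1 i) (toℚᵘ-/1 j)))

    fromℤ-neg : ∀ i → fromℤ (ℤ.- i) ≈ - fromℤ i
    fromℤ-neg i = ≈-pointwise λ _ → /1-via-ℚᵘ (ℤ.- i) (ℚᵘ.≃-trans (ℚ.toℚᵘ-homo‿- (i ℚ./ 1))
      (ℚᵘ.-‿cong (toℚᵘ-/1 i)))

  ℝ-orderedRing : OrderedRing
  ℝ-orderedRing = record
    { commutativeRing = ℝ-commutativeRing
    ; _≤_ = _≤_
    ; ≤-reflexive = ≤-reflexive
    ; ≤-trans = ≤-trans
    ; ≤-antisym = ≤-antisym
    ; +-mono-≤ = λ {x} {y} {u} {v} → +-mono-≤ {x} {y} {u} {v}
    ; ≤-stable = ≤-stable
    ; ≰⇒≥ = ≰⇒≥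
    ; *-cancelʳ-≤0 = λ {x} {t} → *-cancelʳ-≤0 {x} {t}
    ; 1≰0 = 1≰0
    ; ℤ-homo = record
      { ⟦_⟧ = fromℤ
      ; +-homo = fromℤ-+
      ; *-homo = fromℤ-*
      ; -‿homo = fromℤ-neg
      ; 0-homo = ≈-refl
      ; 1-homo = ≈-refl
      }
    }

-- Transfer to the given spectrum.

open Defs
open Reals using (ℝ-orderedRing)
open import Data.Nat.Properties using (≤-trans; m∸n≤m)

theorem4p6 : ∀ {n k : ℕ} .{{_ : NonZero k}} (2≤k : 2 ℕ.≤ k) (k≤n∸1 : k ℕ.≤ n ℕ.∸ 1)
    (G : Graph n) (connected : Connected G) →
    KPartite G k →
    ¬ Connected (complement G) →
    (∂ : Vector ℝ n) → IsSpectrum (distanceLaplacian G connected) ∂ →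
    let DLS = spread (≤-trans 2≤k (≤-trans k≤n∸1 (m∸n≤m n 1))) ∂ in
    (DLS ≥ fromℕ (n / k)) ×
    (DLS ≈ fromℕ (n / k) ⇔ (n % k ≡ 0 × BalancedCompleteKPartite G k))
theorem4p6 {n} {k} 2≤k k≤n∸1 G connected kPartite disconnected ∂
  (antitone , b , (independent , spanning) , eigen) =
  bounds (≤-trans 2≤k (≤-trans k≤n∸1 (m∸n≤m n 1))) k≤n∸1 G connected kPartite disconnected ∂
    (Ordered.DistanceLaplacian.eigenbasis ℝ-orderedRing G connected disconnected
      {∂} {distanceLaplacian G connected} (λ u v → Reals.≈-pointwise λ _ → ≡.refl)
      antitone b independent spanning eigen)
  where
  -- Stated for an eigenbasis computed at a variable n: once n is a successor, sums
  -- reduce and Agda compares the Cauchy moduli of their terms.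
  bounds : ∀ {n} (2≤n : 2 ℕ.≤ n) → k ℕ.≤ n ℕ.∸ 1 → (G : Graph n) (connected : Connected G) →
    KPartite G k → (disconnected : ¬ Connected (complement G)) → (∂ : Vector ℝ n) →
    Ordered.Eigenbasis ℝ-orderedRing (Ordered.OnePlus.w ℝ-orderedRing
      (Ordered.DistanceLaplacian.E ℝ-orderedRing G connected disconnected)) ∂ →
    (spread 2≤n ∂ ≥ fromℕ (n / k)) ×
    (spread 2≤n ∂ ≈ fromℕ (n / k) ⇔ (n % k ≡ 0 × BalancedCompleteKPartite G k))
  bounds {n} 2≤n@(s≤s (s≤s z≤n)) k≤n∸1 G connected kPartite disconnected ∂ B =
    Ordered.Spread.spread-≥ ℝ-orderedRing G connected disconnected
      {∂} B {spread 2≤n ∂} DLS≈ {k} (s≤s k≤n∸1) kPartite ,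
    Ordered.Spread.spread-≈ ℝ-orderedRing G connected disconnected
      {∂} B {spread 2≤n ∂} DLS≈ {k} (s≤s k≤n∸1) kPartite
    -- Matching on `2≤n` unfolds `spread`; its terms then agree by computation with those of the
    -- difference in the ring, and the Cauchy moduli are left out of the comparison.
    where DLS≈ = Reals.≈-pointwise {spread 2≤n ∂} λ _ → ≡.refl
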